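{- The model checking problem for synchronous TeamLTL can be reduced, in time linear in the length of the given formula and the size of the given model, to the model checking problem for each of the following: $\exists\mathrm{TeamLTL}$, $\forall\mathrm{TeamLTL}(\vee_{\mathrm B},\mathrm{NE})$, $\exists\mathrm{TeamCTL}(\vee_{\mathrm B})$, and $\forall\mathrm{TeamCTL}(\subseteq)$.
   Context: Fix a set $\mathsf{AP}$ of atomic propositions (fresh propositions may be added). A trace is an infinite sequence $t\in(2^{\mathsf{AP}})^\omega$. A multiset is a set of pairs (index, element) with pairwise distinct indices; the index is usually dropped. $T=T_1\uplus T_2$ means that $T$ is partitioned into $T_1$ and $T_2$ (either may be empty). A rooted Kripke structure is $\mathfrak K=(W,R,\eta,r)$ with $W$ a finite non-empty set of states, $R\subseteq W^2$ left-total, $\eta\colon W\to 2^{\mathsf{AP}}$, $r\in W$. A path is $\sigma\in W^\omega$ with $\sigma[0]=r$ and $(\sigma[i],\sigma[i+1])\in R$ for all $i$; its trace is $t(\sigma)=\eta(\sigma[0])\eta(\sigma[1])\cdots$. $\mathrm{Traces}(\mathfrak K)$ is the multiset $\{(\sigma,t(\sigma))\mid\sigma\text{ a path through }\mathfrak K\}$ (indexed by paths). Tefs: for a multiset of traces $T$ and $\tau\colon\mathbb N\times T\to\mathbb N$, write $\tau(i)=(\tau(i,t))_{t\in T}$; for tuples, $\vec a\le\vec b$ is componentwise, and $\vec a<\vec b$ means $\vec a\le\vec b$ and $\vec a\ne\vec b$. $\tau$ is a tef (time evaluation function) for $T$ if for all $i$: $\tau(i)<\tau(i+1)$ and $\tau(i)\le\tau(i+1)\le\tau(i)+\vec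 1$; a stuttering tef if for all $i$: $\tau(i)\le\tau(i+1)\le\tau(i)+\vec 1$; a tef is synchronous if $\tau(i,t)=\tau(i,t')$ for all $i,t,t'$; it is initial if $\tau(0,t)=0$ for all $t$. TeamCTL$^*$ formulae: $\varphi ::= p\mid\neg p\mid(\varphi\lor\varphi)\mid(\varphi\land\varphi)\mid\mathsf X\varphi\mid[\varphi\,\mathsf U\,\varphi]\mid[\varphi\,\mathsf W\,\varphi]\mid\exists\varphi\mid\forall\varphi$. TeamLTL: the fragment without $\exists,\forall$. TeamCTL: the fragment in which each temporal operator directly follows a quantifier and vice versa (operators $\mathsf X_\exists,\mathsf X_\forall,\mathsf U_\exists,\mathsf U_\forall,\mathsf W_\exists,\mathsf W_\forall$). $\exists$TeamCTL (resp. $\forall$TeamCTL): TeamCTL without the $\forall$-modalities (resp. $\exists$-modalities). Semantics, for $\tau$ a stuttering tef for $T$ and $i\in\mathbb N$: $(T,\tau,i)\models p$ iff $p\in t[\tau(i,t)]$ for all $t\in T$; $(T,\tau,i)\models\neg p$ iff $p\notin t[\tau(i,t)]$ for all $t\in T$; $\land$ is conjunction; $(T,\tau,i)\models(\varphi\lor\psi)$ iff there are $T_1\uplus T_2=T$ with $(T_1,\tau,i)\models\varphi$ and $(T_2,\tau,i)\models\psi$ (with $\tau$ restricted accordingly); $(T,\tau,i)\models\mathsf X\varphi$ iff $(T,\tau,i+1)\models\varphi$; $(T,\tau,i)\models[\varphi\,\mathsf U\,\psi]$ iff there is $k\ge i$ with $(T,\tau,k)\models\psi$ and $(T,\tau,m)\models\varphi$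 for all $i\le m<k$; $(T,\tau,i)\models[\varphi\,\mathsf W\,\psi]$ iff for all $k\ge i$, $(T,\tau,k)\models\varphi$ or there is $m$ with $i\le m\le k$ and $(T,\tau,m)\models\psi$; $(T,\tau,i)\models\exists\varphi$ (resp. $\forall\varphi$) iff $(T,\tau',i)\models\varphi$ for some (resp. all) tef(s) $\tau'$ for $T$ with $\tau'(j,t)=\tau(j,t)$ for all $j\le i$, $t\in T$. Extensions: $L(\mathcal C)$ is $L$ extended with the atoms and connectives in $\mathcal C$. Boolean disjunction $\vee_{\mathrm B}$ (distinct from $\lor$): $(T,\tau,i)\models(\varphi\vee_{\mathrm B}\psi)$ iff $(T,\tau,i)\models\varphi$ or $(T,\tau,i)\models\psi$. Non-emptiness: $(T,\tau,i)\models\mathrm{NE}$ iff $T\ne\emptyset$. Inclusion atom, for propositional formulae $\varphi_j,\psi_j$: $(T,\tau,i)\models\varphi_1,\dots,\varphi_n\subseteq\psi_1,\dots,\psi_n$ iff for all $t\in T$ there is $t'\in T$ such that for all $j$ the truth value of $\varphi_j$ at position $\tau(i,t)$ of $t$ equals that of $\psi_j$ at position $\tau(i,t')$ of $t'$. $T\models_\exists\varphi$ (resp. $T\models_\forall\varphi$) means $(T,\tau,0)\models\varphi$ for some (resp. all) initial tef(s) $\tau$ for $T$. $T\models_s\varphi$ means $(T,\tau,0)\models\varphi$ for the unique initial synchronous tef $\tau$ for $T$. The model checking problem: given a formula $\varphi$ and a Kripke structure $\mathfrak K$, does $\mathrm{Traces}(\mathfrak K)\models_*\varphi$ hold? Here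 $\models_*$ is $\models_s$ for synchronous TeamLTL, $\models_\exists$ for $\exists$TeamLTL and $\exists$TeamCTL (and extensions), and $\models_\forall$ for $\forall$TeamLTL and $\forall$TeamCTL (and extensions). -}

module Defs where

open import Data.Bool using (Bool; true; false; not)
open import Data.Fin using (Fin)
open import Data.List using (List; []; _∷_; _++_; [_]; map; concat; concatMap; catMaybes; length; reverse; tabulate)
open import Data.List.Membership.Propositional using (_∈_)
open import Data.Maybe using (Maybe; just; nothing)
open import Data.Nat using (ℕ; zero; suc; _+_; _*_; _≤_; _<_; _≟_)
open import Data.Nat.Binary using (ℕᵇ; 2[1+_]; 1+[2_]; fromℕ) renaming (zero to 0ᵇ)
open import Data.Product using (Σ; ∃; ∃₂; ∃-syntax; _×_; _,_; proj₁)
open import Data.Sum using (_⊎_)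
open import Data.Vec using (Vec; []; _∷_; replicate; zipWith) renaming (map to mapᵛ; lookup to lookupᵛ; toList to toListᵛ)
open import Function using (_∘_; _⇔_)
open import Relation.Binary.PropositionalEquality using (_≡_; _≗_)
open import Relation.Nullary using (¬_; does)

import Data.Bool as Bool
import Data.Fin as Fin
import Data.List.Membership.DecPropositional as DecMembership
open DecMembership _≟_ using (_∈?_)

-- An infinite supply of propositions: every input mentions only finitely
-- many of them, so fresh ones are always available.
AP : Set
AP = ℕ

Trace : Set
Trace = ℕ → AP → Bool

-- A multiset of traces; the index keeps equal traces apart.
record Team : Set₁ where
  field
    Index : Set
    trace : Index → Trace

open Team public

_↾_ : (T : Team) → (Index T → Bool) → Team
T ↾ c = record
  { Index = Σ (Index T) (λ t → c t ≡ true)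
  ; trace = trace T ∘ proj₁
  }

Timing : Team → Set
Timing T = ℕ → Index T → ℕ

_↾ᵗ_ : ∀ {T} → Timing T → (c : Index T → Bool) → Timing (T ↾ c)
(τ ↾ᵗ c) i = τ i ∘ proj₁

module _ {I : Set} where

  infix 4 _≤⃗_ _<⃗_

  _≤⃗_ : (I → ℕ) → (I → ℕ) → Set
  a ≤⃗ b = ∀ t → a t ≤ b t

  _<⃗_ : (I → ℕ) → (I → ℕ) → Set
  a <⃗ b = a ≤⃗ b × ¬ (a ≗ b)

  _+1⃗ : (I → ℕ) → (I → ℕ)
  (a +1⃗) t = a t + 1

-- The empty team has no tef, since its only tuple is not below itself;
-- it does have a stuttering tef.
IsTef : (T : Team) → Timing T → Set
IsTef T τ = ∀ i → τ i <⃗ τ (suc i) × τ i ≤⃗ τ (suc i) × τ (suc i) ≤⃗ (τ i +1⃗)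

Synchronous : (T : Team) → Timing T → Set
Synchronous T τ = ∀ i t t′ → τ i t ≡ τ i t′

Initial : (T : Team) → Timing T → Set
Initial T τ = ∀ t → τ 0 t ≡ 0

data PropFormula : Set where
  atom natom  : AP → PropFormula
  _∨ᵖ_ _∧ᵖ_   : PropFormula → PropFormula → PropFormula

eval : PropFormula → (AP → Bool) → Bool
eval (atom p)  v = v p
eval (natom p) v = not (v p)
eval (φ ∨ᵖ ψ)  v = eval φ v Bool.∨ eval ψ v
eval (φ ∧ᵖ ψ)  v = eval φ v Bool.∧ eval ψ v

data Quantifier : Set where
  some all : Quantifier

-- TeamCTL* with all the extensions; the logics are predicates on it.
data Formula : Set where
  prop nprop        : AP → Formula
  _∨_ _∧_           : Formula → Formula → Formula
  X_                : Formula → Formula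
  _U_ _W_           : Formula → Formula → Formula
  quant             : Quantifier → Formula → Formula
  _∨ᴮ_              : Formula → Formula → Formula
  NE                : Formula
  _⊆_               : ∀ {n} → Vec PropFormula (suc n) → Vec PropFormula (suc n) → Formula

data Extension : Set where
  bor ne incl : Extension

data TeamLTL (C : List Extension) : Formula → Set where
  prop  : ∀ p → TeamLTL C (prop p)
  nprop : ∀ p → TeamLTL C (nprop p)
  disj  : ∀ {φ ψ} → TeamLTL C φ → TeamLTL C ψ → TeamLTL C (φ ∨ ψ)
  conj  : ∀ {φ ψ} → TeamLTL C φ → TeamLTL C ψ → TeamLTL C (φ ∧ ψ)
  next  : ∀ {φ} → TeamLTL C φ → TeamLTL C (X φ)
  until : ∀ {φ ψ} → TeamLTL C φ → TeamLTL C ψ → TeamLTL C (φ U ψ)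
  weak  : ∀ {φ ψ} → TeamLTL C φ → TeamLTL C ψ → TeamLTL C (φ W ψ)
  bor   : bor ∈ C → ∀ {φ ψ} → TeamLTL C φ → TeamLTL C ψ → TeamLTL C (φ ∨ᴮ ψ)
  ne    : ne ∈ C → TeamLTL C NE
  incl  : incl ∈ C → ∀ {n} (φs ψs : Vec PropFormula (suc n)) → TeamLTL C (φs ⊆ ψs)

-- TeamCTL restricted to the modalities whose quantifier is in Q.
data TeamCTL (Q : List Quantifier) (C : List Extension) : Formula → Set where
  prop  : ∀ p → TeamCTL Q C (prop p)
  nprop : ∀ p → TeamCTL Q C (nprop p)
  disj  : ∀ {φ ψ} → TeamCTL Q C φ → TeamCTL Q C ψ → TeamCTL Q C (φ ∨ ψ)
  conj  : ∀ {φ ψ} → TeamCTL Q C φ → TeamCTL Q C ψ → TeamCTL Q C (φ ∧ ψ)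
  next  : ∀ {q} → q ∈ Q → ∀ {φ} → TeamCTL Q C φ → TeamCTL Q C (quant q (X φ))
  until : ∀ {q} → q ∈ Q → ∀ {φ ψ} → TeamCTL Q C φ → TeamCTL Q C ψ → TeamCTL Q C (quant q (φ U ψ))
  weak  : ∀ {q} → q ∈ Q → ∀ {φ ψ} → TeamCTL Q C φ → TeamCTL Q C ψ → TeamCTL Q C (quant q (φ W ψ))
  bor   : bor ∈ C → ∀ {φ ψ} → TeamCTL Q C φ → TeamCTL Q C ψ → TeamCTL Q C (φ ∨ᴮ ψ)
  ne    : ne ∈ C → TeamCTL Q C NE
  incl  : incl ∈ C → ∀ {n} (φs ψs : Vec PropFormula (suc n)) → TeamCTL Q C (φs ⊆ ψs)

-- Meant for stuttering tefs τ only; the notions of truth below start from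
-- tefs, and restricting a tef to a subteam yields a stuttering tef.
_,_,_⊨_ : (T : Team) → Timing T → ℕ → Formula → Set
T , τ , i ⊨ prop p  = ∀ t → trace T t (τ i t) p ≡ true
T , τ , i ⊨ nprop p = ∀ t → trace T t (τ i t) p ≡ false
-- The partition T₁ ⊎ T₂ = T is given by its characteristic function.
T , τ , i ⊨ (φ ∨ ψ) = ∃[ c ] ((T ↾ c) , _↾ᵗ_ {T} τ c , i ⊨ φ)
                           × ((T ↾ (not ∘ c)) , _↾ᵗ_ {T} τ (not ∘ c) , i ⊨ ψ)
T , τ , i ⊨ (φ ∧ ψ) = (T , τ , i ⊨ φ) × (T , τ , i ⊨ ψ)
T , τ , i ⊨ (X φ)   = T , τ , suc i ⊨ φ
T , τ , i ⊨ (φ U ψ) = ∃[ k ] i ≤ k × (T , τ , k ⊨ ψ)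
                           × (∀ m → i ≤ m → m < k → T , τ , m ⊨ φ)
T , τ , i ⊨ (φ W ψ) = ∀ k → i ≤ k →
                        (T , τ , k ⊨ φ)
                        ⊎ (∃[ m ] i ≤ m × m ≤ k × (T , τ , m ⊨ ψ))
T , τ , i ⊨ quant some φ = ∃[ τ′ ] IsTef T τ′ × (∀ j → j ≤ i → ∀ t → τ′ j t ≡ τ j t)
                                 × (T , τ′ , i ⊨ φ)
T , τ , i ⊨ quant all φ  = ∀ τ′ → IsTef T τ′ → (∀ j → j ≤ i → ∀ t → τ′ j t ≡ τ j t) →
                             T , τ′ , i ⊨ φ
T , τ , i ⊨ (φ ∨ᴮ ψ) = (T , τ , i ⊨ φ) ⊎ (T , τ , i ⊨ ψ)
T , τ , i ⊨ NE       = Index T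
T , τ , i ⊨ (φs ⊆ ψs) = ∀ t → ∃[ t′ ] ∀ j →
                          eval (lookupᵛ φs j) (trace T t (τ i t))
                          ≡ eval (lookupᵛ ψs j) (trace T t′ (τ i t′))

_⊨∃_ : Team → Formula → Set
T ⊨∃ φ = ∃[ τ ] IsTef T τ × Initial T τ × (T , τ , 0 ⊨ φ)

_⊨∀_ : Team → Formula → Set
T ⊨∀ φ = ∀ τ → IsTef T τ → Initial T τ → T , τ , 0 ⊨ φ

-- On a non-empty team λ i t → i is, up to pointwise equality, the only
-- synchronous initial tef.
_⊨ₛ_ : Team → Formula → Set
T ⊨ₛ φ = ∃[ τ ] IsTef T τ × Synchronous T τ × Initial T τ × (T , τ , 0 ⊨ φ)

-- Finite sets are given by lists of their elements (adjacency lists and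
-- lists of true propositions), so that structures are finite data.
record Kripke : Set where
  field
    states : ℕ
    succs  : Fin states → List (Fin states)
    total  : ∀ w → ∃[ v ] v ∈ succs w
    label  : Fin states → List AP
    root   : Fin states

  _R_ : Fin states → Fin states → Set
  w R v = v ∈ succs w

  η : Fin states → AP → Bool
  η w p = does (p ∈? label w)

  -- The conditions are irrelevant so that a path is nothing more than its
  -- sequence of states; otherwise different membership proofs would
  -- contribute several copies of the same path to the multiset of traces.
  record Path : Set where
    field
      at     : ℕ → Fin states
      .start : at 0 ≡ root
      .step  : ∀ i → at i R at (suc i)

  Traces : Team
  Traces = record
    { Index = Path
    ; trace = λ σ i → η (Path.at σ i)
    }

open Kripke public using (Traces)

record Problem : Set₁ where
  field
    Admissible : Formula → Set
    _⊨*_       : Team → Formula → Set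

sync-TeamLTL : Problem
sync-TeamLTL = record { Admissible = TeamLTL [] ; _⊨*_ = _⊨ₛ_ }

∃TeamLTL ∀TeamLTL ∃TeamCTL ∀TeamCTL : List Extension → Problem
∃TeamLTL C = record { Admissible = TeamLTL C ; _⊨*_ = _⊨∃_ }
∀TeamLTL C = record { Admissible = TeamLTL C ; _⊨*_ = _⊨∀_ }
∃TeamCTL C = record { Admissible = TeamCTL [ some ] C ; _⊨*_ = _⊨∃_ }
∀TeamCTL C = record { Admissible = TeamCTL [ all ] C ; _⊨*_ = _⊨∀_ }

data Symbol : Set where
  ONE TWO END SEP : Symbol
  PROP NPROP OR AND NEXT UNTIL WEAK SOME ALL BOR NONEMPTY INCL : Symbol

-- Numbers are written in binary (in the bijective digits 1 and 2 of ℕᵇ,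
-- least significant digit first) and delimited by `END`.
digits : ℕᵇ → List Symbol
digits 0ᵇ       = []
digits 2[1+ n ] = TWO ∷ digits n
digits 1+[2 n ] = ONE ∷ digits n

number : ℕ → List Symbol
number n = digits (fromℕ n) ++ [ END ]

encodeᵖ : PropFormula → List Symbol
encodeᵖ (atom p)  = PROP ∷ number p
encodeᵖ (natom p) = NPROP ∷ number p
encodeᵖ (φ ∨ᵖ ψ)  = OR ∷ encodeᵖ φ ++ encodeᵖ ψ
encodeᵖ (φ ∧ᵖ ψ)  = AND ∷ encodeᵖ φ ++ encodeᵖ ψ

-- Polish notation, uniquely readable without parentheses.
encodeᶠ : Formula → List Symbol
encodeᶠ (prop p)       = PROP ∷ number p
encodeᶠ (nprop p)      = NPROP ∷ number p
encodeᶠ (φ ∨ ψ)        = OR ∷ encodeᶠ φ ++ encodeᶠ ψ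
encodeᶠ (φ ∧ ψ)        = AND ∷ encodeᶠ φ ++ encodeᶠ ψ
encodeᶠ (X φ)          = NEXT ∷ encodeᶠ φ
encodeᶠ (φ U ψ)        = UNTIL ∷ encodeᶠ φ ++ encodeᶠ ψ
encodeᶠ (φ W ψ)        = WEAK ∷ encodeᶠ φ ++ encodeᶠ ψ
encodeᶠ (quant some φ) = SOME ∷ encodeᶠ φ
encodeᶠ (quant all φ)  = ALL ∷ encodeᶠ φ
encodeᶠ (φ ∨ᴮ ψ)       = BOR ∷ encodeᶠ φ ++ encodeᶠ ψ
encodeᶠ NE             = NONEMPTY ∷ []
encodeᶠ (φs ⊆ ψs)      = INCL ∷ concatMap encodeᵖ (toListᵛ φs) ++ END
                              ∷ concatMap encodeᵖ (toListᵛ ψs) ++ [ END ]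

-- The number of the root, followed by the labels and successors of each
-- state in turn; there are as many states as such rows.
encodeᴷ : Kripke → List Symbol
encodeᴷ K = number (Fin.toℕ root) ++ concat (tabulate row)
  where
  open Kripke K
  row : Fin states → List Symbol
  row w = concatMap number (label w) ++ SEP
        ∷ concatMap (number ∘ Fin.toℕ) (succs w) ++ [ SEP ]

encode : Formula → Kripke → List Symbol
encode φ K = encodeᶠ φ ++ SEP ∷ encodeᴷ K

-- Tape cells hold a symbol or are blank (`nothing`); the tape is infinite
-- in both directions and blank beyond the two lists. Cells to the left are
-- listed starting from the head.
Cell : Set
Cell = Maybe Symbol

record Tape : Set where
  constructor tape
  field
    lefts  : List Cell
    head   : Cell
    rights : List Cell

blank : Tape
blank = tape [] nothing []

data Move : Set where
  left stay right : Move

act : Tape → Cell × Move → Tape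
act (tape []       _ rs)       (x , left)  = tape [] nothing (x ∷ rs)
act (tape (l ∷ ls) _ rs)       (x , left)  = tape ls l (x ∷ rs)
act (tape ls       _ rs)       (x , stay)  = tape ls x rs
act (tape ls       _ [])       (x , right) = tape (x ∷ ls) nothing []
act (tape ls       _ (r ∷ rs)) (x , right) = tape (x ∷ ls) r rs

load : List Symbol → Tape
load []       = blank
load (x ∷ xs) = tape [] (just x) (map just xs)

contents : Tape → List Symbol
contents (tape ls x rs) = catMaybes (reverse ls ++ x ∷ rs)

-- An input tape, an output tape and any number of work tapes. The machine
-- halts when δ is `nothing`.
record TM : Set₁ where
  field
    worktapes : ℕ
    State     : Set
    allStates : List State
    finite    : ∀ s → s ∈ allStates
    initial   : State
    δ         : State → Vec Cell (2 + worktapes) →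
                Maybe (State × Vec (Cell × Move) (2 + worktapes))

  Config : Set
  Config = State × Vec Tape (2 + worktapes)

  successor : Config → Maybe Config
  successor (s , ts) with δ s (mapᵛ Tape.head ts)
  ... | nothing         = nothing
  ... | just (s′ , ops) = just (s′ , zipWith act ts ops)

  data _⇓[_]_ : Config → ℕ → Config → Set where
    halt : ∀ {c} → successor c ≡ nothing → c ⇓[ 0 ] c
    step : ∀ {c c′ d n} → successor c ≡ just c′ → c′ ⇓[ n ] d → c ⇓[ suc n ] d

  start : List Symbol → Config
  start u = initial , load u ∷ blank ∷ replicate worktapes blank

  output : Config → List Symbol
  output (_ , _ ∷ t ∷ _) = contents t

  -- On input u the machine halts with output v after at most b steps.
  Computes_to_within_ : List Symbol → List Symbol → ℕ → Set
  Computes u to v within b = ∃₂ λ n d → start u ⇓[ n ] d × n ≤ b × output d ≡ v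

LinearTimeReducible : Problem → Problem → Set₁
LinearTimeReducible P Q =
  Σ TM λ M → Σ ℕ λ c →
    ∀ (φ : Formula) (K : Kripke) → P.Admissible φ →
      Σ Formula λ φ′ → Σ Kripke λ K′ →
        Q.Admissible φ′
        × TM.Computes_to_within_ M (encode φ K) (encode φ′ K′)
            (c * (length (encodeᶠ φ) + length (encodeᴷ K)))
        × ((Traces K P.⊨* φ) ⇔ (Traces K′ Q.⊨* φ′))
  where
  module P = Problem P
  module Q = Problem Q

{-# OPTIONS --safe #-}
-- Replace every state of the model by two copies, alternating along the
-- edges, and let a fresh proposition o hold in the second. The paths stay the
-- same, but o now tells the parity of the position. A team in lockstep agrees
-- on o at all times, and the first time a tef leaves some traces behind, the
-- team disagrees on o. So logics can speak about synchronicity: through a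
-- conjunct G (o U ¬o) in ∃TeamLTL, through an alternative
-- F (both o and ¬o occur) in ∀TeamLTL, and in TeamCTL through a guard in front
-- of every subformula. Renaming p to 2p + 1, and the copies of w to 2w + 1 and
-- 2w + 2, puts one digit in front of a numeral in bijective base 2, so the
-- output is obtained symbol by symbol, reading each row of the model twice.
module Submission where

open import Defs
open import Axiom.ExcludedMiddle using (ExcludedMiddle)
open import Axiom.Extensionality.Propositional using (Extensionality)
open import Data.Bool using (Bool; true; false; not)
open import Data.Bool.Properties using (not-¬; not-injective; not-involutive; ¬-not)
open import Data.Fin using (Fin; zero; suc; toℕ; combine; remQuot; opposite)
open import Data.Fin.Patterns using (0F; 1F)
open import Data.Fin.Properties using (remQuot-combine; toℕ-combine) renaming (_≟_ to _≟ᶠ_)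
open import Data.List
  using ( List; []; _∷_; [_]; _++_; _ʳ++_; map; concat; concatMap; catMaybes; mapMaybe; length; reverse; tabulate; allFin
        ; cartesianProduct; cartesianProductWith)
open import Data.List.Membership.Propositional using (_∈_)
open import Data.List.Membership.Propositional.Properties
  using (∈-map⁺; ∈-map⁻; ∈-allFin; ∈-++⁺ˡ; ∈-++⁺ʳ; ∈-cartesianProduct⁺; ∈-cartesianProductWith⁺)
open import Data.List.Properties
  using ( ++-assoc; ++-identityʳ; ++-ʳ++; ʳ++-ʳ++; ʳ++-defn; reverse-involutive; reverse-map; length-++; length-reverse
        ; catMaybes-++; mapMaybe-just; concatMap-++; concatMap-map; concatMap-cong; tabulate-cong)
open import Data.List.Relation.Unary.All as All using (All; []; _∷_)
open import Data.List.Relation.Unary.All.Properties using (++⁺)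
open import Data.List.Relation.Unary.Any using (here; there)
open import Data.List.Relation.Unary.Any.Properties using (reverse⁻)
open import Data.Maybe using (just; nothing)
open import Data.Nat using (ℕ; zero; suc; _+_; _*_; _≤_; _<_; z≤n; s≤s; s≤s⁻¹; _≤′_; ≤′-refl; ≤′-step; _≟_)
open import Data.Nat.Binary using (2[1+_]; 1+[2_]; fromℕ) renaming (zero to 0ᵇ; toℕ to toℕᵇ)
open import Data.Nat.Binary.Properties using (fromℕ-toℕ; toℕ-fromℕ)
open import Data.Nat.Properties
  using ( suc-injective; +-comm; +-assoc; +-identityʳ; *-suc; *-distribˡ-+; *-cancelˡ-≡; +-monoˡ-≤; +-monoʳ-≤; m≤m+n
        ; ≤-refl; ≤-reflexive; ≤-trans; ≤-<-trans; ≤-antisym; <-irrefl; <⇒≤; n≤1+n; 1+n≢n; m≤n⇒m<n∨m≡n; m≤n⇒m≤1+n; n≤0⇒n≡0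
        ; ≤⇒≤′; ≤′⇒≤)
open import Data.Nat.Solver using (module +-*-Solver)
open import Data.Product using (∃; _×_; _,_; proj₁; proj₂)
open import Data.Sum as Sum using (_⊎_; inj₁; inj₂)
open import Data.Vec using ([]; _∷_)
open import Function using (_∘_; id; _⇔_; mk⇔; Equivalence)
open import Function.Construct.Composition using (_⇔-∘_)
open import Level using (0ℓ)
open import Relation.Binary.PropositionalEquality using (_≡_; refl; sym; trans; cong; cong₂; subst; module ≡-Reasoning)
open import Relation.Nullary using (¬_; does; yes; no; contradiction)
open import Relation.Nullary.Decidable using (dec-true; dec-false; does-⇔; recompute)

import Data.List.Membership.DecPropositional as DecMembership
open DecMembership _≟_ using (_∈?_)

-- All four correctness proofs compare with one statement: the renamed formula holds of the doubled
-- team under `lockstep`. For the TeamLTL targets the tef is chosen once, so a single conjunct or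
-- alternative at the outside suffices. A TeamCTL modality replaces the tef after the present
-- moment, so synchrony can be enforced only at positions where a subformula is evaluated, and the
-- invariant of the induction is synchrony of the past.
--
-- Splitting produces empty teams, and these shape the TeamCTL targets. The empty team has
-- stuttering tefs but no tef: an existential modality fails on it and a universal one says nothing
-- about it, whereas every plain TeamLTL formula holds of it. The existential case is repaired in
-- the formula, the universal one in the soundness proof. Excluded middle decides whether a team is
-- empty and whether its parities ever disagree.
--
-- The machine gets by without work tapes because everything it inserts is a fixed word, carried in
-- its state until written.

module Translation (guard modal : Formula → Formula) (ρ : AP → AP) where

  translate core : ∀ {φ} → TeamLTL [] φ → Formula
  translate d = guard (core d)

  core (prop p)    = prop (ρ p)
  core (nprop p)   = nprop (ρ p)
  core (disj d e)  = translate d ∨ translate e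
  core (conj d e)  = translate d ∧ translate e
  core (next d)    = modal (X translate d)
  core (until d e) = modal (translate d U translate e)
  core (weak d e)  = modal (translate d W translate e)
  core (bor () _ _)
  core (ne ())
  core (incl () _ _)

-- Renaming propositions and comparing teams.

open Translation using (translate; core)

-- With both wrappers trivial only the propositions change. The TeamLTL targets use this formula
-- itself; for the TeamCTL targets it is the reference with which the guarded formula is compared.
rename : (AP → AP) → ∀ {φ} → TeamLTL [] φ → Formula
rename = translate id id

rename-id : ∀ {φ} (d : TeamLTL [] φ) → rename id d ≡ φ
rename-id (prop p)    = refl
rename-id (nprop p)   = refl
rename-id (disj d e)  rewrite rename-id d | rename-id e = refl
rename-id (conj d e)  rewrite rename-id d | rename-id e = refl
rename-id (next d)    rewrite rename-id d = refl
rename-id (until d e) rewrite rename-id d | rename-id e = refl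
rename-id (weak d e)  rewrite rename-id d | rename-id e = refl
rename-id (bor () _ _)
rename-id (ne ())
rename-id (incl () _ _)

rename-TeamLTL : ∀ {C} ρ {φ} (d : TeamLTL [] φ) → TeamLTL C (rename ρ d)
rename-TeamLTL ρ (prop p)    = prop (ρ p)
rename-TeamLTL ρ (nprop p)   = nprop (ρ p)
rename-TeamLTL ρ (disj d e)  = disj (rename-TeamLTL ρ d) (rename-TeamLTL ρ e)
rename-TeamLTL ρ (conj d e)  = conj (rename-TeamLTL ρ d) (rename-TeamLTL ρ e)
rename-TeamLTL ρ (next d)    = next (rename-TeamLTL ρ d)
rename-TeamLTL ρ (until d e) = until (rename-TeamLTL ρ d) (rename-TeamLTL ρ e)
rename-TeamLTL ρ (weak d e)  = weak (rename-TeamLTL ρ d) (rename-TeamLTL ρ e)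
rename-TeamLTL ρ (bor () _ _)
rename-TeamLTL ρ (ne ())
rename-TeamLTL ρ (incl () _ _)

-- TeamLTL is downward closed and blind to multiplicities, so f need be
-- neither injective nor surjective.
transfer : ∀ {φ} (d : TeamLTL [] φ) ρ ρ′ {T T′ τ τ′} (f : Index T′ → Index T) →
           (∀ i t p → trace T (f t) (τ i (f t)) (ρ p) ≡ trace T′ t (τ′ i t) (ρ′ p)) →
           ∀ i → T , τ , i ⊨ rename ρ d → T′ , τ′ , i ⊨ rename ρ′ d
transfer (prop p)    ρ ρ′ f same i h t = trans (sym (same i t p)) (h (f t))
transfer (nprop p)   ρ ρ′ f same i h t = trans (sym (same i t p)) (h (f t))
transfer (disj d e)  ρ ρ′ f same i (c , h , k) =
  c ∘ f ,
  transfer d ρ ρ′ (λ (t , q) → f t , q) (λ j t → same j (proj₁ t)) i h ,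
  transfer e ρ ρ′ (λ (t , q) → f t , q) (λ j t → same j (proj₁ t)) i k
transfer (conj d e)  ρ ρ′ f same i (h , k) = transfer d ρ ρ′ f same i h , transfer e ρ ρ′ f same i k
transfer (next d)    ρ ρ′ f same i h = transfer d ρ ρ′ f same (suc i) h
transfer (until d e) ρ ρ′ f same i (k , i≤k , h , g) =
  k , i≤k , transfer e ρ ρ′ f same k h , λ m i≤m m<k → transfer d ρ ρ′ f same m (g m i≤m m<k)
transfer (weak d e)  ρ ρ′ f same i h k i≤k with h k i≤k
... | inj₁ g = inj₁ (transfer d ρ ρ′ f same k g)
... | inj₂ (m , i≤m , m≤k , g) = inj₂ (m , i≤m , m≤k , transfer e ρ ρ′ f same m g)
transfer (bor () _ _)
transfer (ne ())
transfer (incl () _ _)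

-- Literals are vacuous and every connective preserves this. It settles the empty subteams of a
-- split, for which `lockstep` is not a tef.
empty-⊨ : ∀ {φ} (d : TeamLTL [] φ) ρ {T τ i} → ¬ Index T → T , τ , i ⊨ rename ρ d
empty-⊨ (prop p)    ρ ∅ t = contradiction t ∅
empty-⊨ (nprop p)   ρ ∅ t = contradiction t ∅
empty-⊨ (disj d e)  ρ ∅ = (λ _ → true) , empty-⊨ d ρ (∅ ∘ proj₁) , empty-⊨ e ρ (∅ ∘ proj₁)
empty-⊨ (conj d e)  ρ ∅ = empty-⊨ d ρ ∅ , empty-⊨ e ρ ∅
empty-⊨ (next d)    ρ ∅ = empty-⊨ d ρ ∅
empty-⊨ (until d e) ρ {i = i} ∅ = i , ≤-refl , empty-⊨ e ρ ∅ , λ m _ _ → empty-⊨ d ρ ∅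
empty-⊨ (weak d e)  ρ ∅ k i≤k = inj₁ (empty-⊨ d ρ ∅)
empty-⊨ (bor () _ _)
empty-⊨ (ne ())
empty-⊨ (incl () _ _)

-- Lockstep, parity and the first loss of synchrony.

lockstep : {I : Set} → ℕ → I → ℕ
lockstep i _ = i

lockstep-tef : ∀ T → Index T → IsTef T lockstep
lockstep-tef T t i =
  ((λ _ → n≤1+n i) , λ eq → 1+n≢n (sym (eq t))) , (λ _ → n≤1+n i) , λ _ → ≤-reflexive (+-comm 1 i)

odd : ℕ → Bool
odd zero    = false
odd (suc n) = not (odd n)

module _ {I : Set} (τ : ℕ → I → ℕ) where

  -- Bounded by `i` because a quantifier keeps a tef only up to the present, and absolute, so that
  -- the timing can be exchanged for `lockstep` there.
  Synced : ℕ → Set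
  Synced i = ∀ j → j ≤ i → ∀ t → τ j t ≡ j

  Uniform : ℕ → Set
  Uniform i = ∃ λ b → ∀ t → odd (τ i t) ≡ b

  -- Shaped like an inclusion atom: vacuous for the empty team, and otherwise saying that both
  -- parities occur.
  Mixed : ℕ → Set
  Mixed i = ∀ t → ∃ λ t′ → odd (τ i t) ≡ not (odd (τ i t′))

module _ {I : Set} {τ : ℕ → I → ℕ} where

  Synced-≤ : ∀ {i j} → i ≤ j → Synced τ j → Synced τ i
  Synced-≤ i≤j s k k≤i = s k (≤-trans k≤i i≤j)

  Synced-agree : ∀ {τ′ : ℕ → I → ℕ} {i} → (∀ j → j ≤ i → ∀ t → τ′ j t ≡ τ j t) → Synced τ i → Synced τ′ i
  Synced-agree agree s j j≤i t = trans (agree j j≤i t) (s j j≤i t)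

  Synced-initial : (∀ t → τ 0 t ≡ 0) → Synced τ 0
  Synced-initial init j j≤0 t with refl ← n≤0⇒n≡0 j≤0 = init t

  -- A trace without a partner of opposite parity makes its own parity common to the whole team.
  uniform-or-mixed : ExcludedMiddle 0ℓ → ∀ i → Uniform τ i ⊎ Mixed τ i
  uniform-or-mixed em i with em {P = Uniform τ i}
  ... | yes u = inj₁ u
  ... | no ¬u = inj₂ opposite-of
    where
    opposite-of : Mixed τ i
    opposite-of t with em {P = ∃ λ t′ → odd (τ i t) ≡ not (odd (τ i t′))}
    ... | yes found = found
    ... | no none   = contradiction
      (odd (τ i t) , λ t′ → sym (trans (¬-not (λ eq → none (t′ , eq))) (not-involutive _))) ¬u

lockstep-Synced : ∀ {I : Set} {i} → Synced {I} lockstep i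
lockstep-Synced _ _ _ = refl

next-position : ∀ {T τ i} → IsTef T τ → Synced τ i → ∀ t → τ (suc i) t ≡ i ⊎ τ (suc i) t ≡ suc i
next-position {T} {τ} {i} tef s t
  with m≤n⇒m<n∨m≡n (subst (_≤ τ (suc i) t) (s i ≤-refl t) (proj₁ (proj₂ (tef i)) t))
... | inj₂ i≡ = inj₁ (sym i≡)
... | inj₁ i< = inj₂ (≤-antisym
  (≤-trans (proj₂ (proj₂ (tef i)) t) (≤-reflexive (trans (+-comm _ 1) (cong suc (s i ≤-refl t))))) i<)

-- In one step of a tef some trace moves, changing its parity, and none
-- moves by more than one position; if the parities agree, all have moved.
advance : ∀ {T τ i} → IsTef T τ → Synced τ i → Uniform τ (suc i) → Synced τ (suc i)
advance {T} {τ} {i} tef s (b , u) j j≤1+i t with m≤n⇒m<n∨m≡n j≤1+i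
... | inj₁ j<1+i = s j (s≤s⁻¹ j<1+i) t
... | inj₂ refl with next-position {T} tef s t
...   | inj₂ moved  = moved
...   | inj₁ stayed = contradiction none-moved (proj₂ (proj₁ (tef i)))
  where
  none-moved : ∀ t′ → τ i t′ ≡ τ (suc i) t′
  none-moved t′ with next-position {T} tef s t′
  ... | inj₁ eq = trans (s i ≤-refl t′) (sym eq)
  ... | inj₂ eq = contradiction
    (trans (cong odd (sym stayed)) (trans (u t) (trans (sym (u t′)) (cong odd eq)))) (not-¬ refl)

-- Uniformity is asked only strictly after `i`: that is where the guards below a modality supply it,
-- and up to `i` the tef is inherited.
advance-to : ∀ {T τ i k} → IsTef T τ → Synced τ i → i ≤′ k →
             (∀ m → m ≤ k → i < m → Uniform τ m) → Synced τ k
advance-to tef s ≤′-refl u = s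
advance-to {T} tef s (≤′-step i≤k) u =
  advance {T} tef (advance-to {T} tef s i≤k (λ m m≤k → u m (m≤n⇒m≤1+n m≤k))) (u _ ≤-refl (s≤s (≤′⇒≤ i≤k)))

-- Stop at the first disagreement of parities. Up to `m` all is in lockstep, and the disagreement
-- shows at `suc m`, still within `k`, so an operator can be discharged there.
synced-or-mixed : ∀ {T τ i k} → ExcludedMiddle 0ℓ → IsTef T τ → Synced τ i → i ≤′ k →
                  Synced τ k ⊎ ∃ λ m → i ≤ m × m < k × Synced τ m × Mixed τ (suc m)
synced-or-mixed em tef s ≤′-refl = inj₁ s
synced-or-mixed {T} {τ} {k = suc k} em tef s (≤′-step i≤k) with synced-or-mixed {T} em tef s i≤k
... | inj₂ (m , i≤m , m<k , found) = inj₂ (m , i≤m , m≤n⇒m≤1+n m<k , found)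
... | inj₁ s′ with uniform-or-mixed {τ = τ} em (suc k)
...   | inj₁ u = inj₁ (advance {T} tef s′ u)
...   | inj₂ x = inj₂ (k , ≤′⇒≤ i≤k , ≤-refl , s′ , x)

synced-at : ∀ {T τ i} (v : Bool) (p : AP) → Synced τ i →
            (∀ t → trace T t (τ i t) p ≡ v) ⇔ (∀ t → trace T t i p ≡ v)
synced-at {T} {τ} {i} v p s = mk⇔
  (λ h t → subst (λ n → trace T t n p ≡ v) (s i ≤-refl t) (h t))
  (λ h t → subst (λ n → trace T t n p ≡ v) (sym (s i ≤-refl t)) (h t))

-- The clock and what formulas can say about it.

clock : AP
clock = 0

fresh : AP → AP
fresh p = suc (2 * p)

Clocked : Team → Set
Clocked T = ∀ t i → trace T t i clock ≡ odd i

o ō contradictory uniform : Formula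
o = prop clock
ō = nprop clock
-- Defines emptiness of the team without any extension. As a release of `W` on a non-empty team it
-- turns `W` into "always".
contradictory = o ∧ ō
uniform = o ∨ᴮ ō

contradictory-empty : ∀ T {τ i} → T , τ , i ⊨ contradictory → ¬ Index T
contradictory-empty T (h , k) t = contradiction (trans (sym (h t)) (k t)) λ ()

uniform⇒Uniform : ∀ T {τ i} → Clocked T → T , τ , i ⊨ uniform → Uniform τ i
uniform⇒Uniform T {τ} clk (inj₁ h) = true  , λ t → trans (sym (clk t _)) (h t)
uniform⇒Uniform T {τ} clk (inj₂ h) = false , λ t → trans (sym (clk t _)) (h t)

Synced⇒uniform : ∀ T {τ i} → Clocked T → Synced τ i → T , τ , i ⊨ uniform
Synced⇒uniform T {τ} {i} clk s with odd i in eq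
... | true  = inj₁ λ t → trans (clk t _) (trans (cong odd (s i ≤-refl t)) eq)
... | false = inj₂ λ t → trans (clk t _) (trans (cong odd (s i ≤-refl t)) eq)

-- ∃TeamLTL

-- `o ∨ ō` would split the team and say nothing. The until decides for the whole team at once: its
-- witness is either now, giving `ō`, or later, giving `o` now. In lockstep it is fulfilled after at
-- most one step, since the clock alternates.
always-uniform : Formula
always-uniform = (o U ō) W contradictory

module LTL∃ {φ} (d : TeamLTL [] φ) (T : Team) (t₀ : Index T) (clk : Clocked T) where

  complete : T , lockstep , 0 ⊨ rename fresh d → T ⊨∃ (always-uniform ∧ rename fresh d)
  complete h = lockstep , lockstep-tef T t₀ , (λ _ → refl) , (λ k _ → inj₁ (alternates k)) , h
    where
    alternates : ∀ k → T , lockstep , k ⊨ (o U ō)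
    alternates k with odd k in eq
    ... | false = k , ≤-refl , (λ t → trans (clk t k) eq) ,
                  λ m k≤m m<k → contradiction (≤-<-trans k≤m m<k) (<-irrefl refl)
    ... | true  = suc k , n≤1+n k , (λ t → trans (clk t (suc k)) (cong not eq)) ,
                  λ m k≤m m<1+k t → trans (clk t m) (trans (cong odd (≤-antisym (s≤s⁻¹ m<1+k) k≤m)) eq)

  sound : T ⊨∃ (always-uniform ∧ rename fresh d) → T , lockstep , 0 ⊨ rename fresh d
  sound (τ , tef , init , g , h) =
    transfer d fresh fresh id (λ i t p → cong (λ n → trace T t n (fresh p)) (synced i i ≤-refl t)) 0 h
    where
    uniform-at : ∀ k → Uniform τ k
    uniform-at k with g k z≤n
    ... | inj₂ (_ , _ , _ , x) = contradiction t₀ (contradictory-empty T {τ} x)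
    ... | inj₁ (l , k≤l , h , g′) with m≤n⇒m<n∨m≡n k≤l
    ...   | inj₁ k<l  = uniform⇒Uniform T {τ} clk (inj₁ (g′ k ≤-refl k<l))
    ...   | inj₂ refl = uniform⇒Uniform T {τ} clk (inj₂ h)
    synced : ∀ i → Synced τ i
    synced i = advance-to {T} tef (Synced-initial init) (≤⇒≤′ z≤n) (λ m _ _ → uniform-at m)

-- ∀TeamLTL(∨ᴮ, NE)

-- Every team satisfies `o ∨ ō`, split by its clock values, so the until reads "eventually". The two
-- `NE` force both values to occur.
sometimes-mixed : Formula
sometimes-mixed = (o ∨ ō) U ((NE ∧ o) ∨ (NE ∧ ō))

by-clock : ∀ T (τ : Timing T) i → T , τ , i ⊨ (o ∨ ō)
by-clock T τ i = (λ t → trace T t (τ i t) clock) , proj₂ , λ (_ , off) → not-injective off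

split-by-clock : ∀ T {τ : Timing T} {i} t t′ →
                 trace T t (τ i t) clock ≡ true → trace T t′ (τ i t′) clock ≡ false →
                 T , τ , i ⊨ ((NE ∧ o) ∨ (NE ∧ ō))
split-by-clock T {τ} {i} t t′ on off =
  proj₁ (by-clock T τ i) ,
  ((t , on) , proj₁ (proj₂ (by-clock T τ i))) ,
  ((t′ , cong not off) , proj₂ (proj₂ (by-clock T τ i)))

module LTL∀ (em : ExcludedMiddle 0ℓ) {φ} (d : TeamLTL [] φ) (T : Team) (t₀ : Index T) (clk : Clocked T) where

  sound : T ⊨∀ (sometimes-mixed ∨ᴮ rename fresh d) → T , lockstep , 0 ⊨ rename fresh d
  sound h with h lockstep (lockstep-tef T t₀) (λ _ → refl)
  ... | inj₂ h′ = h′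
  ... | inj₁ (k , _ , (c , (t , ht) , (t′ , ht′)) , _) = contradiction
    (trans (sym (ht t)) (trans (clk (proj₁ t) k) (trans (sym (clk (proj₁ t′) k)) (ht′ t′)))) λ ()

  complete : T , lockstep , 0 ⊨ rename fresh d → T ⊨∀ (sometimes-mixed ∨ᴮ rename fresh d)
  complete h τ tef init with em {P = ∃ λ k → T , τ , k ⊨ ((NE ∧ o) ∨ (NE ∧ ō))}
  ... | yes (k , mixed) =
    inj₁ (k , z≤n , mixed , λ m _ _ → by-clock T τ m)
  ... | no ¬mixed =
    inj₂ (transfer d fresh fresh id (λ i t p → cong (λ n → trace T t n (fresh p)) (sym (synced i i ≤-refl t))) 0 h)
    where
    uniform-at : ∀ k → Uniform τ k
    uniform-at k with uniform-or-mixed {τ = τ} em k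
    ... | inj₁ u = u
    -- `Mixed` alone may be vacuous; `t₀` supplies one clock value and its partner the other.
    ... | inj₂ x = contradiction (k , split) ¬mixed
      where
      clock-opposite : ∀ {t b} → trace T t₀ (τ k t₀) clock ≡ not b → odd (τ k t₀) ≡ not (odd (τ k t)) →
                       trace T t (τ k t) clock ≡ b
      clock-opposite {t} eq opp = trans (clk t _) (not-injective (trans (sym opp) (trans (sym (clk t₀ _)) eq)))
      split : T , τ , k ⊨ ((NE ∧ o) ∨ (NE ∧ ō))
      split with trace T t₀ (τ k t₀) clock in eq | x t₀
      ... | true  | (t , opp) = split-by-clock T {τ} t₀ t eq (clock-opposite eq opp)
      ... | false | (t , opp) = split-by-clock T {τ} t t₀ (clock-opposite eq opp) eq
    synced : ∀ i → Synced τ i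
    synced i = advance-to {T} tef (Synced-initial init) (≤⇒≤′ z≤n) (λ m _ _ → uniform-at m)

-- ∃TeamCTL(∨ᴮ)

module CTL∃ (em : ExcludedMiddle 0ℓ) where

  -- `modal` offers an alternative that holds of the empty team, for which the quantifier finds no
  -- tef. `guard` uses Boolean disjunction, so that one clock value is chosen for the whole team.
  guard modal : Formula → Formula
  guard θ = uniform ∧ θ
  modal θ = contradictory ∨ᴮ quant some θ

  target : ∀ {φ} → TeamLTL [] φ → Formula
  target = translate guard modal fresh

  admissible : ∀ {φ} (d : TeamLTL [] φ) → TeamCTL (some ∷ []) (bor ∷ []) (target d)
  admissible-core : ∀ {φ} (d : TeamLTL [] φ) → TeamCTL (some ∷ []) (bor ∷ []) (core guard modal fresh d)
  admissible d = conj (bor (here refl) (prop clock) (nprop clock)) (admissible-core d)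

  admissible-core (prop p)    = prop (fresh p)
  admissible-core (nprop p)   = nprop (fresh p)
  admissible-core (disj d e)  = disj (admissible d) (admissible e)
  admissible-core (conj d e)  = conj (admissible d) (admissible e)
  admissible-core (next d)    =
    bor (here refl) (conj (prop clock) (nprop clock)) (next (here refl) (admissible d))
  admissible-core (until d e) =
    bor (here refl) (conj (prop clock) (nprop clock)) (until (here refl) (admissible d) (admissible e))
  admissible-core (weak d e)  =
    bor (here refl) (conj (prop clock) (nprop clock)) (weak (here refl) (admissible d) (admissible e))
  admissible-core (bor () _ _)
  admissible-core (ne ())
  admissible-core (incl () _ _)

  -- The tef chosen at a modality inherits a synchronous past, and the guards at the positions
  -- visited afterwards extend this step by step.
  sound : ∀ {φ} (d : TeamLTL [] φ) T {τ i} → Clocked T → Synced τ i →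
          T , τ , i ⊨ target d → T , lockstep , i ⊨ rename fresh d
  sound (prop p) T {τ} clk s (_ , h) = Equivalence.to (synced-at {T} {τ} true (fresh p) s) h
  sound (nprop p) T {τ} clk s (_ , h) = Equivalence.to (synced-at {T} {τ} false (fresh p) s) h
  sound (disj d e) T clk s (_ , c , h , k) =
    c , sound d (T ↾ c) (clk ∘ proj₁) (λ j j≤i → s j j≤i ∘ proj₁) h ,
        sound e (T ↾ (not ∘ c)) (clk ∘ proj₁) (λ j j≤i → s j j≤i ∘ proj₁) k
  sound (conj d e) T clk s (_ , h , k) = sound d T clk s h , sound e T clk s k
  sound (next d) T {τ} clk s (_ , inj₁ x) = empty-⊨ d fresh (contradictory-empty T {τ} x)
  sound (next d) T clk s (_ , inj₂ (τ , tef , agree , h)) =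
    sound d T clk (advance {T} tef (Synced-agree agree s) (uniform⇒Uniform T {τ} clk (proj₁ h))) h
  sound (until d e) T {τ} clk s (_ , inj₁ x) = empty-⊨ (until d e) fresh (contradictory-empty T {τ} x)
  sound (until d e) T {i = i} clk s (_ , inj₂ (τ , tef , agree , k , i≤k , h , g)) =
    k , i≤k , sound e T clk synced h , λ m i≤m m<k → sound d T clk (Synced-≤ (<⇒≤ m<k) synced) (g m i≤m m<k)
    where
    uniform-at : ∀ m → m ≤ k → i < m → Uniform τ m
    uniform-at m m≤k i<m with m≤n⇒m<n∨m≡n m≤k
    ... | inj₁ m<k  = uniform⇒Uniform T {τ} clk (proj₁ (g m (<⇒≤ i<m) m<k))
    ... | inj₂ refl = uniform⇒Uniform T {τ} clk (proj₁ h)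
    synced : Synced τ k
    synced = advance-to {T} tef (Synced-agree agree s) (≤⇒≤′ i≤k) uniform-at
  sound (weak d e) T {τ} clk s (_ , inj₁ x) = empty-⊨ (weak d e) fresh (contradictory-empty T {τ} x)
  sound (weak d e) T {i = i} clk s (_ , inj₂ (τ , tef , agree , h)) k i≤k with until-released (≤⇒≤′ i≤k)
    where
    Released : ℕ → Set
    Released k = ∃ λ m → i ≤ m × m ≤ k × (T , lockstep , m ⊨ rename fresh e)
    -- Nothing guards the tef after a release, so synchrony is propagated only up to one. A release
    -- at an earlier time is translated at once; one at `suc k` brings its own guard.
    until-released : ∀ {k} → i ≤′ k → Synced τ k ⊎ Released k
    until-released ≤′-refl = inj₁ (Synced-agree agree s)
    until-released (≤′-step {k} i≤k) with until-released i≤k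
    ... | inj₂ (m , i≤m , m≤k , g) = inj₂ (m , i≤m , m≤n⇒m≤1+n m≤k , g)
    ... | inj₁ s′ with h (suc k) (m≤n⇒m≤1+n (≤′⇒≤ i≤k))
    ...   | inj₁ g = inj₁ (advance {T} tef s′ (uniform⇒Uniform T {τ} clk (proj₁ g)))
    ...   | inj₂ (m , i≤m , m≤1+k , g) with m≤n⇒m<n∨m≡n m≤1+k
    ...     | inj₁ m<1+k =
      inj₂ (m , i≤m , m≤1+k , sound e T clk (Synced-≤ (s≤s⁻¹ m<1+k) s′) g)
    ...     | inj₂ refl = inj₁ (advance {T} tef s′ (uniform⇒Uniform T {τ} clk (proj₁ g)))
  ... | inj₂ released = inj₂ released
  ... | inj₁ s′ with h k i≤k
  ...   | inj₁ g = inj₁ (sound d T clk s′ g)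
  ...   | inj₂ (m , i≤m , m≤k , g) = inj₂ (m , i≤m , m≤k , sound e T clk (Synced-≤ m≤k s′) g)
  sound (bor () _ _)
  sound (ne ())
  sound (incl () _ _)

  -- `lockstep` continues any synchronous past, so it may answer the quantifier; the empty team
  -- takes the other alternative.
  modal-lockstep : ∀ T {τ i} θ → Synced τ i → T , lockstep , i ⊨ θ → T , τ , i ⊨ modal θ
  modal-lockstep T θ s h with em {P = Index T}
  ... | yes t = inj₂ (lockstep , lockstep-tef T t , (λ j j≤i t → sym (s j j≤i t)) , h)
  ... | no ∅  = inj₁ ((λ t → contradiction t ∅) , (λ t → contradiction t ∅))

  complete : ∀ {φ} (d : TeamLTL [] φ) T {τ i} → Clocked T → Synced τ i →
             T , lockstep , i ⊨ rename fresh d → T , τ , i ⊨ target d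
  complete-core : ∀ {φ} (d : TeamLTL [] φ) T {τ i} → Clocked T → Synced τ i →
                  T , lockstep , i ⊨ rename fresh d → T , τ , i ⊨ core guard modal fresh d
  complete d T clk s h = Synced⇒uniform T clk s , complete-core d T clk s h

  complete-core (prop p) T {τ} clk s h = Equivalence.from (synced-at {T} {τ} true (fresh p) s) h
  complete-core (nprop p) T {τ} clk s h = Equivalence.from (synced-at {T} {τ} false (fresh p) s) h
  complete-core (disj d e) T clk s (c , h , k) =
    c , complete d (T ↾ c) (clk ∘ proj₁) (λ j j≤i → s j j≤i ∘ proj₁) h ,
        complete e (T ↾ (not ∘ c)) (clk ∘ proj₁) (λ j j≤i → s j j≤i ∘ proj₁) k
  complete-core (conj d e) T clk s (h , k) = complete d T clk s h , complete e T clk s k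
  complete-core (next d) T clk s h =
    modal-lockstep T (X target d) s (complete d T clk lockstep-Synced h)
  complete-core (until d e) T clk s (k , i≤k , h , g) =
    modal-lockstep T (target d U target e) s
      (k , i≤k , complete e T clk lockstep-Synced h , λ m i≤m m<k → complete d T clk lockstep-Synced (g m i≤m m<k))
  complete-core (weak d e) T clk s h =
    modal-lockstep T (target d W target e) s λ k i≤k →
      Sum.map (complete d T clk lockstep-Synced)
              (λ (m , i≤m , m≤k , g) → m , i≤m , m≤k , complete e T clk lockstep-Synced g) (h k i≤k)
  complete-core (bor () _ _)
  complete-core (ne ())
  complete-core (incl () _ _)

-- ∀TeamCTL(⊆)

-- Holds of the empty team and of teams mixing both clock values, so that
-- splitting with it acts as "mixed or".
mixed : Formula
mixed = (atom clock ∷ []) ⊆ (natom clock ∷ [])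

Mixed⇒mixed : ∀ T {τ i} → Clocked T → Mixed τ i → T , τ , i ⊨ mixed
Mixed⇒mixed T clk x t with t′ , opp ← x t =
  t′ , λ { Fin.zero → trans (clk t _) (trans opp (cong not (sym (clk t′ _)))) }

mixed⇒¬Synced : ∀ T {τ i} → Clocked T → Synced τ i → T , τ , i ⊨ mixed → ¬ Index T
mixed⇒¬Synced T {τ} {i} clk s x t with t′ , opp ← x t = not-¬ refl (begin
  odd i                                ≡⟨ cong odd (s i ≤-refl t) ⟨
  odd (τ i t)                          ≡⟨ clk t _ ⟨
  trace T t (τ i t) clock              ≡⟨ opp Fin.zero ⟩
  not (trace T t′ (τ i t′) clock)      ≡⟨ cong not (clk t′ _) ⟩
  not (odd (τ i t′))                   ≡⟨ cong (not ∘ odd) (s i ≤-refl t′) ⟩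
  not (odd i)                          ∎)
  where open ≡-Reasoning

module CTL∀ (em : ExcludedMiddle 0ℓ) where

  -- Over the empty team `quant all` is vacuously true, so `modal` needs no further alternative; in
  -- return it yields information only about non-empty teams.
  guard modal : Formula → Formula
  guard θ = mixed ∨ θ
  modal θ = quant all θ

  target : ∀ {φ} → TeamLTL [] φ → Formula
  target = translate guard modal fresh

  admissible : ∀ {φ} (d : TeamLTL [] φ) → TeamCTL (all ∷ []) (incl ∷ []) (target d)
  admissible-core : ∀ {φ} (d : TeamLTL [] φ) → TeamCTL (all ∷ []) (incl ∷ []) (core guard modal fresh d)
  admissible d = disj (incl (here refl) _ _) (admissible-core d)

  admissible-core (prop p)    = prop (fresh p)
  admissible-core (nprop p)   = nprop (fresh p)
  admissible-core (disj d e)  = disj (admissible d) (admissible e)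
  admissible-core (conj d e)  = conj (admissible d) (admissible e)
  admissible-core (next d)    = next (here refl) (admissible d)
  admissible-core (until d e) = until (here refl) (admissible d) (admissible e)
  admissible-core (weak d e)  = weak (here refl) (admissible d) (admissible e)
  admissible-core (bor () _ _)
  admissible-core (ne ())
  admissible-core (incl () _ _)

  modal-lockstep : ∀ T {τ i} θ → Index T → Synced τ i → T , τ , i ⊨ modal θ → T , lockstep , i ⊨ θ
  modal-lockstep T θ t s h = h lockstep (lockstep-tef T t) (λ j j≤i t → sym (s j j≤i t))

  -- The mixed side of the guard's split is empty for a synchronous team, so the other side is the
  -- whole team up to re-indexing, which `transfer` undoes.
  sound : ∀ {φ} (d : TeamLTL [] φ) T {τ i} → Clocked T → Synced τ i →
          T , τ , i ⊨ target d → T , lockstep , i ⊨ rename fresh d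
  sound-core : ∀ {φ} (d : TeamLTL [] φ) T {τ i} → Index T → Clocked T → Synced τ i →
               T , τ , i ⊨ core guard modal fresh d → T , lockstep , i ⊨ rename fresh d
  sound d T {τ} {i} clk s (c , x , h) with em {P = Index T}
  ... | no ∅  = empty-⊨ d fresh ∅
  ... | yes t₀ =
    transfer d fresh fresh (λ t → t , other-side t) (λ _ _ _ → refl) i
      (sound-core d (T ↾ (not ∘ c)) (t₀ , other-side t₀) (clk ∘ proj₁) (λ j j≤i → s j j≤i ∘ proj₁) h)
    where
    other-side : ∀ t → not (c t) ≡ true
    other-side t with c t in eq
    ... | false = refl
    ... | true  = contradiction (t , eq)
      (mixed⇒¬Synced (T ↾ c) (clk ∘ proj₁) (λ j j≤i → s j j≤i ∘ proj₁) x)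

  sound-core (prop p) T {τ} t₀ clk s h = Equivalence.to (synced-at {T} {τ} true (fresh p) s) h
  sound-core (nprop p) T {τ} t₀ clk s h = Equivalence.to (synced-at {T} {τ} false (fresh p) s) h
  sound-core (disj d e) T t₀ clk s (c , h , k) =
    c , sound d (T ↾ c) (clk ∘ proj₁) (λ j j≤i → s j j≤i ∘ proj₁) h ,
        sound e (T ↾ (not ∘ c)) (clk ∘ proj₁) (λ j j≤i → s j j≤i ∘ proj₁) k
  sound-core (conj d e) T t₀ clk s (h , k) = sound d T clk s h , sound e T clk s k
  sound-core (next d) T t₀ clk s h =
    sound d T clk lockstep-Synced (modal-lockstep T (X target d) t₀ s h)
  sound-core (until d e) T t₀ clk s h
    with k , i≤k , h′ , g ← modal-lockstep T (target d U target e) t₀ s h =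
    k , i≤k , sound e T clk lockstep-Synced h′ , λ m i≤m m<k → sound d T clk lockstep-Synced (g m i≤m m<k)
  sound-core (weak d e) T t₀ clk s h k i≤k =
    Sum.map (sound d T clk lockstep-Synced)
            (λ (m , i≤m , m≤k , g) → m , i≤m , m≤k , sound e T clk lockstep-Synced g)
            (modal-lockstep T (target d W target e) t₀ s h k i≤k)
  sound-core (bor () _ _)
  sound-core (ne ())
  sound-core (incl () _ _)

  complete : ∀ {φ} (d : TeamLTL [] φ) T {τ i} → Clocked T → Synced τ i →
             T , lockstep , i ⊨ rename fresh d → T , τ , i ⊨ target d
  -- All traces go to the mixed side. What remains is the empty team, vacuously synchronous, to
  -- which `complete-core` applies.
  escape : ∀ {φ} (d : TeamLTL [] φ) T {τ i} → Clocked T → Mixed τ i → T , τ , i ⊨ target d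
  complete-core : ∀ {φ} (d : TeamLTL [] φ) T {τ i} → Clocked T → Synced τ i →
                  T , lockstep , i ⊨ rename fresh d → T , τ , i ⊨ core guard modal fresh d

  complete d T {τ} {i} clk s h =
    (λ _ → false) , (λ ()) ,
    complete-core d (T ↾ (λ _ → true)) (clk ∘ proj₁) (λ j j≤i → s j j≤i ∘ proj₁)
      (transfer d fresh fresh proj₁ (λ _ _ _ → refl) i h)
  escape d T {τ} clk x =
    (λ _ → true) ,
    Mixed⇒mixed (T ↾ (λ _ → true)) {_↾ᵗ_ {T} τ (λ _ → true)} (clk ∘ proj₁)
      (λ (t , _) → let t′ , opp = x t in (t′ , refl) , opp) ,
    complete-core d (T ↾ (λ _ → false)) (clk ∘ proj₁) (λ { _ _ (_ , ()) }) (empty-⊨ d fresh λ { (_ , ()) })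

  complete-core (prop p) T {τ} clk s h = Equivalence.from (synced-at {T} {τ} true (fresh p) s) h
  complete-core (nprop p) T {τ} clk s h = Equivalence.from (synced-at {T} {τ} false (fresh p) s) h
  complete-core (disj d e) T clk s (c , h , k) =
    c , complete d (T ↾ c) (clk ∘ proj₁) (λ j j≤i → s j j≤i ∘ proj₁) h ,
        complete e (T ↾ (not ∘ c)) (clk ∘ proj₁) (λ j j≤i → s j j≤i ∘ proj₁) k
  complete-core (conj d e) T clk s (h , k) = complete d T clk s h , complete e T clk s k
  complete-core (next d) T clk s h τ′ tef agree
    with synced-or-mixed {T} em tef (Synced-agree agree s) (≤′-step ≤′-refl)
  ... | inj₁ s′ = complete d T clk s′ h
  ... | inj₂ (m , i≤m , m<1+i , _ , x) with refl ← ≤-antisym i≤m (s≤s⁻¹ m<1+i) = escape d T clk x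
  complete-core (until d e) T clk s (k , i≤k , h , g) τ′ tef agree
    with synced-or-mixed {T} em tef (Synced-agree agree s) (≤⇒≤′ i≤k)
  ... | inj₁ s′ =
    k , i≤k , complete e T clk s′ h , λ m i≤m m<k → complete d T clk (Synced-≤ (<⇒≤ m<k) s′) (g m i≤m m<k)
  ... | inj₂ (m , i≤m , m<k , s′ , x) =
    -- The moment of desynchronisation itself ends the until: it comes no later than `k`, and all
    -- positions before it are still in lockstep.
    suc m , m≤n⇒m≤1+n i≤m , escape e T clk x ,
    λ l i≤l l≤m → complete d T clk (Synced-≤ (s≤s⁻¹ l≤m) s′) (g l i≤l (≤-<-trans (s≤s⁻¹ l≤m) m<k))
  complete-core (weak d e) T clk s h τ′ tef agree k i≤k
    with synced-or-mixed {T} em tef (Synced-agree agree s) (≤⇒≤′ i≤k)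
  ... | inj₁ s′ =
    Sum.map (complete d T clk s′)
            (λ (m , i≤m , m≤k , g) → m , i≤m , m≤k , complete e T clk (Synced-≤ m≤k s′) g) (h k i≤k)
  ... | inj₂ (m , i≤m , m<k , _ , x) = inj₂ (suc m , m≤n⇒m≤1+n i≤m , m<k , escape e T clk x)
  complete-core (bor () _ _)
  complete-core (ne ())
  complete-core (incl () _ _)

-- The doubled model.

fresh-injective : ∀ {p q} → fresh p ≡ fresh q → p ≡ q
fresh-injective = *-cancelˡ-≡ _ _ 2 ∘ suc-injective

module Doubling (K : Kripke) where
  open Kripke K hiding (Traces)

  -- State 0 is unreachable: it makes the copies of w the states 2 w + 1 and
  -- 2 w + 2, whose numerals are that of w with one digit put in front.
  copy : Fin states → Fin 2 → Fin (suc (states * 2))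
  copy w b = suc (combine w b)

  origin : Fin (states * 2) → Fin states × Fin 2
  origin = remQuot 2

  copyLabel : Fin states × Fin 2 → List AP
  copyLabel (w , 0F) = map fresh (label w)
  copyLabel (w , 1F) = clock ∷ map fresh (label w)

  copySuccs : Fin states × Fin 2 → List (Fin (suc (states * 2)))
  copySuccs (w , b) = map (λ v → copy v (opposite b)) (succs w)

  doubled : Kripke
  doubled = record
    { states = suc (states * 2)
    ; succs  = λ { zero → zero ∷ [] ; (suc x) → copySuccs (origin x) }
    ; total  = λ { zero → zero , here refl
                 ; (suc x) → _ , ∈-map⁺ _ (proj₂ (total (proj₁ (origin x)))) }
    ; label  = λ { zero → [] ; (suc x) → copyLabel (origin x) }
    ; root   = copy root 0F
    }

  module D = Kripke doubled

  clock∉ : ∀ ps → ¬ clock ∈ map fresh ps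
  clock∉ ps c∈ with ∈-map⁻ fresh c∈
  ... | _ , _ , ()

  bit : Bool → Fin 2
  bit false = 0F
  bit true  = 1F

  opposite-bit : ∀ b → opposite (bit b) ≡ bit (not b)
  opposite-bit false = refl
  opposite-bit true  = refl

  η-clock : ∀ w b → D.η (copy w (bit b)) clock ≡ b
  η-clock w b rewrite remQuot-combine w (bit b) = value b
    where
    value : ∀ b → does (clock ∈? copyLabel (w , bit b)) ≡ b
    value false = dec-false (clock ∈? _) (clock∉ (label w))
    value true  = dec-true (clock ∈? copyLabel (w , 1F)) (here refl)

  fresh∈⇔ : ∀ w b p → fresh p ∈ copyLabel (w , b) ⇔ p ∈ label w
  fresh∈⇔ w b p = mk⇔ (to b) (from b)
    where
    to′ : fresh p ∈ map fresh (label w) → p ∈ label w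
    to′ p∈ with q , q∈ , eq ← ∈-map⁻ fresh p∈ = subst (_∈ label w) (sym (fresh-injective eq)) q∈
    to : ∀ b → fresh p ∈ copyLabel (w , b) → p ∈ label w
    to 0F p∈         = to′ p∈
    to 1F (there p∈) = to′ p∈
    from : ∀ b → p ∈ label w → fresh p ∈ copyLabel (w , b)
    from 0F p∈ = ∈-map⁺ fresh p∈
    from 1F p∈ = there (∈-map⁺ fresh p∈)

  η-fresh : ∀ w b p → D.η (copy w b) (fresh p) ≡ η w p
  η-fresh w b p rewrite remQuot-combine w b =
    does-⇔ (fresh∈⇔ w b p) (fresh p ∈? copyLabel (w , b)) (p ∈? label w)

  label-copy : ∀ w b → D.label (copy w b) ≡ copyLabel (w , b)
  label-copy w b = cong copyLabel (remQuot-combine w b)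

  succs-copy : ∀ w b → D.succs (copy w b) ≡ map (λ v → copy v (opposite b)) (succs w)
  succs-copy w b = cong copySuccs (remQuot-combine w b)

  copy-step : ∀ w v b → v ∈ succs w → copy v (opposite b) ∈ D.succs (copy w b)
  copy-step w v b v∈ = subst (copy v (opposite b) ∈_) (sym (succs-copy w b)) (∈-map⁺ _ v∈)

  copy-step⁻ : ∀ {w b x} → x ∈ D.succs (copy w b) → ∃ λ v → v ∈ succs w × x ≡ copy v (opposite b)
  copy-step⁻ {w} {b} x∈ = ∈-map⁻ _ (subst (_ ∈_) (succs-copy w b) x∈)

  base : Fin (suc (states * 2)) → Fin states
  -- An arbitrary value: no path visits state 0.
  base zero    = root
  base (suc x) = proj₁ (origin x)

  base-copy : ∀ w b → base (copy w b) ≡ w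
  base-copy w b = cong proj₁ (remQuot-combine w b)

  OnPhase : (ℕ → Fin (suc (states * 2))) → ℕ → Set
  OnPhase at i = at i ≡ copy (base (at i)) (bit (odd i))

  copy-phase : ∀ {x} w b → x ≡ copy w b → x ≡ copy (base x) b
  copy-phase w b refl = cong (λ v → copy v b) (sym (base-copy w b))

  -- Stated for a bare sequence with its conditions as relevant arguments, because the conditions
  -- stored in a path can only be passed on irrelevantly.
  on-phase : ∀ at → at 0 ≡ copy root 0F → (∀ i → at (suc i) ∈ D.succs (at i)) → ∀ i → OnPhase at i
  on-phase at start step zero = copy-phase root 0F start
  on-phase at start step (suc i)
    with v , _ , eq ← copy-step⁻ (subst (λ x → at (suc i) ∈ D.succs x) (on-phase at start step i) (step i)) =
    copy-phase v _ (trans eq (cong (copy v) (opposite-bit (odd i))))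

  base-step : ∀ at → at 0 ≡ copy root 0F → (∀ i → at (suc i) ∈ D.succs (at i)) →
              ∀ i → base (at (suc i)) ∈ succs (base (at i))
  base-step at start step i
    with v , v∈ , eq ← copy-step⁻ (subst (λ x → at (suc i) ∈ D.succs x) (on-phase at start step i) (step i)) =
    subst (_∈ succs (base (at i))) (sym (trans (cong base eq) (base-copy v _))) v∈

  lift : Path → D.Path
  lift record { at = at ; start = start ; step = step } = record
    { at    = λ i → copy (at i) (bit (odd i))
    ; start = cong (λ w → copy w 0F) start
    ; step  = λ i → subst (λ b → copy (at (suc i)) b ∈ D.succs (copy (at i) (bit (odd i))))
                          (opposite-bit (odd i)) (copy-step (at i) (at (suc i)) (bit (odd i)) (step i))
    }

  lower : D.Path → Path
  lower record { at = at ; start = start ; step = step } = record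
    { at    = base ∘ at
    ; start = trans (cong base start) (base-copy root 0F)
    ; step  = base-step at start step
    }

  -- The path conditions are irrelevant, so `on-phase` gives only an irrelevant equality;
  -- decidability of equality on `Fin` recovers a proper one.
  path-on-phase : ∀ (σ : D.Path) i → OnPhase (D.Path.at σ) i
  path-on-phase record { at = at ; start = start ; step = step } i =
    recompute (at i ≟ᶠ copy (base (at i)) (bit (odd i))) (on-phase at start step i)

  doubled-clocked : Clocked (Traces doubled)
  doubled-clocked σ i = trans (cong (λ x → D.η x clock) (path-on-phase σ i)) (η-clock _ (odd i))

  -- Left-totality makes the team of traces non-empty, which is what makes `lockstep` a tef for it.
  path : Path
  path = record { at = at ; start = refl ; step = λ i → proj₂ (total (at i)) }
    where
    at : ℕ → Fin states
    at zero    = root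
    at (suc i) = proj₁ (total (at i))

  -- Dropping and adding the phase preserve traces up to renaming, and by `transfer` one map in each
  -- direction is enough.
  doubled-⇔ : ∀ {φ} (d : TeamLTL [] φ) →
              (Traces K , lockstep , 0 ⊨ rename id d) ⇔ (Traces doubled , lockstep , 0 ⊨ rename fresh d)
  doubled-⇔ d = mk⇔
    (transfer d id fresh lower
      (λ i σ p → sym (trans (cong (λ x → D.η x (fresh p)) (path-on-phase σ i)) (η-fresh _ _ p))) 0)
    (transfer d fresh id lift (λ i σ p → η-fresh _ _ p) 0)

-- A synchronous tef has uniform parity at every time, so the parity argument identifies it
-- pointwise with `lockstep`.
⊨ₛ-lockstep : ∀ {φ} (d : TeamLTL [] φ) T → Index T → (T ⊨ₛ φ) ⇔ (T , lockstep , 0 ⊨ rename id d)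
⊨ₛ-lockstep {φ} d T t₀ = mk⇔ to from
  where
  to : T ⊨ₛ φ → T , lockstep , 0 ⊨ rename id d
  to (τ , tef , sync , init , h) =
    transfer d id id id (λ i t p → cong (λ n → trace T t n p) (synced i i ≤-refl t)) 0
      (subst (λ θ → T , τ , 0 ⊨ θ) (sym (rename-id d)) h)
    where
    synced : ∀ i → Synced τ i
    synced i = advance-to {T} tef (Synced-initial init) (≤⇒≤′ z≤n)
                 (λ m _ _ → odd (τ m t₀) , λ t → cong odd (sync m t t₀))
  from : T , lockstep , 0 ⊨ rename id d → T ⊨ₛ φ
  from h = lockstep , lockstep-tef T t₀ , (λ _ _ _ → refl) , (λ _ → refl) ,
           subst (λ θ → T , lockstep , 0 ⊨ θ) (rename-id d) h

-- Words of bounded length over a finite alphabet.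

infixr 5 _++ᵘ_

-- A state carries a word still to be written; the length bound in the type leaves only finitely
-- many states.
data Upto (A : Set) : ℕ → Set where
  []  : ∀ {n} → Upto A n
  _∷_ : ∀ {n} → A → Upto A n → Upto A (suc n)

toList : ∀ {A n} → Upto A n → List A
toList []       = []
toList (x ∷ xs) = x ∷ toList xs

weaken : ∀ {A n} → Upto A n → Upto A (suc n)
weaken []       = []
weaken (x ∷ xs) = x ∷ weaken xs

toList-weaken : ∀ {A n} (xs : Upto A n) → toList (weaken xs) ≡ toList xs
toList-weaken []       = refl
toList-weaken (x ∷ xs) = cong (x ∷_) (toList-weaken xs)

pad : ∀ {A n} m → Upto A n → Upto A (m + n)
pad zero    xs = xs
pad (suc m) xs = weaken (pad m xs)

toList-pad : ∀ {A n} m (xs : Upto A n) → toList (pad m xs) ≡ toList xs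
toList-pad zero    xs = refl
toList-pad (suc m) xs = trans (toList-weaken (pad m xs)) (toList-pad m xs)

_++ᵘ_ : ∀ {A m n} → Upto A m → Upto A n → Upto A (m + n)
_++ᵘ_ {m = m} [] ys = pad m ys
(x ∷ xs) ++ᵘ ys     = x ∷ (xs ++ᵘ ys)

toList-++ᵘ : ∀ {A m n} (xs : Upto A m) (ys : Upto A n) → toList (xs ++ᵘ ys) ≡ toList xs ++ toList ys
toList-++ᵘ {m = m} [] ys = toList-pad m ys
toList-++ᵘ (x ∷ xs)   ys = cong (x ∷_) (toList-++ᵘ xs ys)

length-toList : ∀ {A n} (xs : Upto A n) → length (toList xs) ≤ n
length-toList []       = z≤n
length-toList (x ∷ xs) = s≤s (length-toList xs)

allUpto : ∀ {A} → List A → ∀ n → List (Upto A n)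
allUpto as zero    = [ [] ]
allUpto as (suc n) = [] ∷ cartesianProductWith _∷_ as (allUpto as n)

∈-allUpto : ∀ {A} {as : List A} → (∀ a → a ∈ as) → ∀ {n} (xs : Upto A n) → xs ∈ allUpto as n
∈-allUpto a∈ {zero}  []       = here refl
∈-allUpto a∈ {suc n} []       = here refl
∈-allUpto a∈ {suc n} (x ∷ xs) = there (∈-cartesianProductWith⁺ _∷_ (a∈ x) (∈-allUpto a∈ xs))

allSymbols : List Symbol
allSymbols =
  ONE ∷ TWO ∷ END ∷ SEP ∷
  PROP ∷ NPROP ∷ OR ∷ AND ∷ NEXT ∷ UNTIL ∷ WEAK ∷ SOME ∷ ALL ∷ BOR ∷ NONEMPTY ∷ INCL ∷ []

∈-allSymbols : ∀ s → s ∈ allSymbols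
∈-allSymbols ONE      = here refl
∈-allSymbols TWO      = there (here refl)
∈-allSymbols END      = there (there (here refl))
∈-allSymbols SEP      = there (there (there (here refl)))
∈-allSymbols PROP     = there (there (there (there (here refl))))
∈-allSymbols NPROP    = there (there (there (there (there (here refl)))))
∈-allSymbols OR       = there (there (there (there (there (there (here refl))))))
∈-allSymbols AND      = there (there (there (there (there (there (there (here refl)))))))
∈-allSymbols NEXT     = there (there (there (there (there (there (there (there (here refl))))))))
∈-allSymbols UNTIL    = there (there (there (there (there (there (there (there (there (here refl)))))))))
∈-allSymbols WEAK     = there (there (there (there (there (there (there (there (there (there (here refl))))))))))
∈-allSymbols SOME     = there (there (there (there (there (there (there (there (there (there (there (here refl)))))))))))
∈-allSymbols ALL      = there (there (there (there (there (there (there (there (there (there (there (there (here refl))))))))))))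
∈-allSymbols BOR      = there (there (there (there (there (there (there (there (there (there (there (there (there (here refl)))))))))))))
∈-allSymbols NONEMPTY = there (there (there (there (there (there (there (there (there (there (there (there (there (there (here refl))))))))))))))
∈-allSymbols INCL     = there (there (there (there (there (there (there (there (there (there (there (there (there (there (there (here refl)))))))))))))))

-- Controls and transitions of the machine.

data Part : Set where
  labels successors : Part

-- `start b p` and `inside b p` produce the row of the copy numbered b of a
-- state, in its part p, from the beginning of a numeral or from within one.
data Control : Set where
  formula rootNumeral : Control
  start inside        : Fin 2 → Part → Control
  rewind              : Part → Control

allParts : List Part
allParts = labels ∷ successors ∷ []

∈-allParts : ∀ p → p ∈ allParts
∈-allParts labels     = here refl
∈-allParts successors = there (here refl)

allControls : List Control
allControls = formula ∷ rootNumeral ∷ map rewind allParts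
  ++ cartesianProductWith start (allFin 2) allParts
  ++ cartesianProductWith inside (allFin 2) allParts

∈-allControls : ∀ q → q ∈ allControls
∈-allControls formula      = here refl
∈-allControls rootNumeral  = there (here refl)
∈-allControls (rewind p)   = there (there (∈-++⁺ˡ (∈-map⁺ rewind (∈-allParts p))))
∈-allControls (start b p)  = there (there (∈-++⁺ʳ (map rewind allParts)
  (∈-++⁺ˡ (∈-cartesianProductWith⁺ start (∈-allFin b) (∈-allParts p)))))
∈-allControls (inside b p) = there (there (∈-++⁺ʳ (map rewind allParts)
  (∈-++⁺ʳ (cartesianProductWith start (allFin 2) allParts)
    (∈-cartesianProductWith⁺ inside (∈-allFin b) (∈-allParts p)))))

digit : Fin 2 → Symbol
digit 0F = ONE
digit 1F = TWO

-- Labels are renamed alike in both copies, with digit 1 for an odd number; edges lead into the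
-- opposite copy.
prefix : Fin 2 → Part → Symbol
prefix b labels     = ONE
prefix b successors = digit (opposite b)

-- Room for a guard and a modality of 10 symbols each and an operator with
-- its digit, or for the 4 symbols after the root.
bound : ℕ
bound = 24

-- A state holds the symbols still to be written. The root numeral's END is
-- overwritten by SEP, so that every row is preceded by a SEP at which
-- rewinding stops; it is followed in the output by the row SEP END SEP of the
-- dummy state 0. The END written after rewinding is the numeral of the clock.
module Machine (preamble : Upto Symbol bound) (image : Symbol → Upto Symbol bound) where

  Action : Set
  Action = Control × Upto Symbol bound × Symbol × Move

  boundary : Fin 2 → Part → Action
  boundary b  labels     = start b successors , SEP ∷ [] , SEP , right
  boundary 0F successors = rewind successors  , SEP ∷ [] , SEP , left
  boundary 1F successors = start 0F labels    , SEP ∷ [] , SEP , right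

  transition : Control → Symbol → Action
  -- The ONE is the digit of the first copy, where the new root lies.
  transition formula             SEP = rootNumeral             , SEP ∷ ONE ∷ []             , SEP , right
  transition formula             x   = formula          , image x                    , x   , right
  transition rootNumeral                END = start 0F labels  , END ∷ SEP ∷ END ∷ SEP ∷ [] , SEP , right
  transition rootNumeral                x   = rootNumeral             , x ∷ []                     , x   , right
  transition (start b p)         SEP = boundary b p
  transition (start b p)         END = start b p        , prefix b p ∷ END ∷ []      , END , right
  transition (start b p)         x   = inside b p       , prefix b p ∷ x ∷ []        , x   , right
  transition (inside b p)        END = start b p        , END ∷ []                   , END , right
  transition (inside b p)        x   = inside b p       , x ∷ []                     , x   , right
  -- On the way left from the end of a row come first the SEP between its parts and then the SEP
  -- before the row; the argument of `rewind` tells them apart.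
  transition (rewind successors) SEP = rewind labels    , []                         , SEP , left
  transition (rewind labels)     SEP = start 1F labels  , END ∷ []                   , SEP , right
  transition (rewind p)          x   = rewind p         , []                         , x   , left

  State : Set
  State = Control × Upto Symbol bound

  machine : TM
  machine = record
    { worktapes = 0
    ; State     = State
    ; allStates = cartesianProduct allControls (allUpto allSymbols bound)
    ; finite    = λ (q , o) → ∈-cartesianProduct⁺ (∈-allControls q) (∈-allUpto ∈-allSymbols o)
    ; initial   = formula , preamble
    ; δ         = λ { (q , s ∷ o) (x ∷ y ∷ [])       → just ((q , weaken o) , (x , stay) ∷ (just s , right) ∷ [])
                    ; (q , [])    (nothing ∷ y ∷ []) → nothing
                    ; (q , [])    (just x ∷ y ∷ [])  →
                        let q′ , o , x′ , move = transition q x in just ((q′ , o) , (just x′ , move) ∷ (y , stay) ∷ []) }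
    }

  open TM machine using (successor; _⇓[_]_; halt; step)

  at : List Symbol → List Symbol → Tape
  at ls []       = tape (map just ls) nothing []
  at ls (x ∷ xs) = tape (map just ls) (just x) (map just xs)

  written : List Symbol → Tape
  written o = at o []

  act-stay : ∀ ls {x y} rs → act (tape ls x rs) (y , stay) ≡ tape ls y rs
  act-stay []       []       = refl
  act-stay []       (_ ∷ _)  = refl
  act-stay (_ ∷ _)  []       = refl
  act-stay (_ ∷ _)  (_ ∷ _)  = refl

  act-right : ∀ ls {x y} xs → act (at ls (x ∷ xs)) (just y , right) ≡ at (y ∷ ls) xs
  act-right []       []       = refl
  act-right []       (_ ∷ _)  = refl
  act-right (_ ∷ _)  []       = refl
  act-right (_ ∷ _)  (_ ∷ _)  = refl

  act-write : ∀ o {y} → act (written o) (just y , right) ≡ written (y ∷ o)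
  act-write []      = refl
  act-write (_ ∷ _) = refl

  -- Runs of the input head and their cost.

  Configuration : Set
  Configuration = Control × List Symbol × List Symbol

  infix 4 _⇒[_,_]_
  infixr 5 _⊕_

  -- Only the steps that read input are counted, and the output is merely collected; `simulate`
  -- accounts for writing. `back` requires a symbol on the left, so the head never leaves the input
  -- on that side.
  data _⇒[_,_]_ : Configuration → ℕ → List Symbol → Configuration → Set where
    done    : ∀ {c} → c ⇒[ 0 , [] ] c
    forward : ∀ {q q′ o x y ls xs n v c} → transition q x ≡ (q′ , o , y , right) →
              (q′ , y ∷ ls , xs) ⇒[ n , v ] c → (q , ls , x ∷ xs) ⇒[ suc n , toList o ++ v ] c
    back    : ∀ {q q′ o x y z ls xs n v c} → transition q x ≡ (q′ , o , y , left) →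
              (q′ , ls , z ∷ y ∷ xs) ⇒[ n , v ] c → (q , z ∷ ls , x ∷ xs) ⇒[ suc n , toList o ++ v ] c

  _⊕_ : ∀ {c d e m n u v} → c ⇒[ m , u ] d → d ⇒[ n , v ] e → c ⇒[ m + n , u ++ v ] e
  done ⊕ s = s
  forward {o = o} eq r ⊕ s = subst (λ w → _ ⇒[ _ , w ] _) (sym (++-assoc (toList o) _ _)) (forward eq (r ⊕ s))
  back    {o = o} eq r ⊕ s = subst (λ w → _ ⇒[ _ , w ] _) (sym (++-assoc (toList o) _ _)) (back eq (r ⊕ s))

  Pass : Control → List Symbol → List Symbol → Control → Set
  Pass q xs o q′ = ∀ ls rest → (q , ls , xs ++ rest) ⇒[ length xs , o ] (q′ , xs ʳ++ ls , rest)

  infixr 5 _∷ᵖ_ _++ᵖ_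

  []ᵖ : ∀ {q} → Pass q [] [] q
  []ᵖ ls rest = done

  _∷ᵖ_ : ∀ {q q′ q″ o x xs v} → transition q x ≡ (q′ , o , x , right) → Pass q′ xs v q″ →
         Pass q (x ∷ xs) (toList o ++ v) q″
  (eq ∷ᵖ r) ls rest = forward eq (r _ rest)

  _++ᵖ_ : ∀ {q q′ q″ xs ys u v} → Pass q xs u q′ → Pass q′ ys v q″ → Pass q (xs ++ ys) (u ++ v) q″
  _++ᵖ_ {xs = xs} {ys} r s ls rest
    rewrite ++-assoc xs ys rest | length-++ xs {ys} | ++-ʳ++ xs {ys} {ls} = r ls (ys ++ rest) ⊕ s (xs ʳ++ ls) rest

  -- The first step may start in another control and rewrite its symbol, so it is a parameter; in
  -- the induction the rewinding step over `z` takes its place.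
  rewind-over : ∀ {q p o x x′ y ls xs} zs → All (λ z → transition (rewind p) z ≡ (rewind p , [] , z , left)) zs →
                transition q x ≡ (rewind p , o , x′ , left) →
                (q , zs ++ y ∷ ls , x ∷ xs) ⇒[ suc (length zs) , toList o ++ [] ] (rewind p , ls , y ∷ (zs ʳ++ x′ ∷ xs))
  rewind-over []       []           eq = back eq done
  rewind-over (z ∷ zs) (eqz ∷ eqzs) eq = back eq (rewind-over zs eqzs eqz)

  rewind-back : ∀ {q p o x x′ y ls xs} zs → All (λ z → transition (rewind p) z ≡ (rewind p , [] , z , left)) zs →
                transition q x ≡ (rewind p , o , x′ , left) →
                (q , zs ʳ++ y ∷ ls , x ∷ xs) ⇒[ suc (length zs) , toList o ++ [] ] (rewind p , ls , y ∷ zs ++ x′ ∷ xs)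
  rewind-back {x′ = x′} {y} {ls} {xs} zs eqs eq
    rewrite ʳ++-defn zs {y ∷ ls} | sym (length-reverse zs) | sym (ʳ++-ʳ++ zs {[]} {x′ ∷ xs}) =
    rewind-over (reverse zs) (All.tabulate (All.lookup eqs ∘ reverse⁻)) eq

  inside-pass : ∀ b p n → Pass (inside b p) (digits n ++ [ END ]) (digits n ++ [ END ]) (start b p)
  inside-pass b p 0ᵇ       = refl ∷ᵖ []ᵖ
  inside-pass b p 2[1+ n ] = refl ∷ᵖ inside-pass b p n
  inside-pass b p 1+[2 n ] = refl ∷ᵖ inside-pass b p n

  number-pass : ∀ b p k → Pass (start b p) (number k) (prefix b p ∷ number k) (start b p)
  number-pass b p k with fromℕ k
  ... | 0ᵇ       = refl ∷ᵖ []ᵖ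
  ... | 2[1+ n ] = refl ∷ᵖ inside-pass b p n
  ... | 1+[2 n ] = refl ∷ᵖ inside-pass b p n

  module _ {A : Set} (f : A → ℕ) where

    numbers : List A → List Symbol
    numbers = concatMap (number ∘ f)

    prefixed : Symbol → List A → List Symbol
    prefixed s = concatMap (λ a → s ∷ number (f a))

    numbers-pass : ∀ b p as → Pass (start b p) (numbers as) (prefixed (prefix b p) as) (start b p)
    numbers-pass b p []       = []ᵖ
    numbers-pass b p (a ∷ as) = number-pass b p (f a) ++ᵖ numbers-pass b p as

    numbers-rewind : ∀ p as → All (λ z → transition (rewind p) z ≡ (rewind p , [] , z , left)) (numbers as)
    numbers-rewind p []       = []
    numbers-rewind p (a ∷ as) = ++⁺ (++⁺ (digits-rewind p (fromℕ (f a))) (end p ∷ [])) (numbers-rewind p as)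
      where
      end : ∀ p → transition (rewind p) END ≡ (rewind p , [] , END , left)
      end labels     = refl
      end successors = refl
      digits-rewind : ∀ p n → All (λ z → transition (rewind p) z ≡ (rewind p , [] , z , left)) (digits n)
      digits-rewind p          0ᵇ       = []
      digits-rewind labels     2[1+ n ] = refl ∷ digits-rewind labels n
      digits-rewind labels     1+[2 n ] = refl ∷ digits-rewind labels n
      digits-rewind successors 2[1+ n ] = refl ∷ digits-rewind successors n
      digits-rewind successors 1+[2 n ] = refl ∷ digits-rewind successors n

  module _ {A B : Set} (f : A → ℕ) (g : B → ℕ) where

    body row : List A → List B → List Symbol
    body as bs = numbers f as ++ SEP ∷ numbers g bs
    row as bs  = body as bs ++ [ SEP ]

    copied : Fin 2 → List A → List B → List Symbol
    copied b as bs = prefixed f ONE as ++ SEP ∷ prefixed g (digit (opposite b)) bs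

    copies : List A → List B → List Symbol
    copies as bs = copied 0F as bs ++ SEP ∷ END ∷ copied 1F as bs ++ [ SEP ]

    body-pass : ∀ b as bs → Pass (start b labels) (body as bs) (copied b as bs) (start b successors)
    body-pass b as bs = numbers-pass f b labels as ++ᵖ refl ∷ᵖ numbers-pass g b successors bs

    rewind-row : ∀ as bs ls rest →
      (start 0F successors , body as bs ʳ++ (SEP ∷ ls) , SEP ∷ rest)
        ⇒[ suc (length (numbers g bs)) + (suc (length (numbers f as)) + 1) , SEP ∷ END ∷ [] ]
      (start 1F labels , SEP ∷ ls , body as bs ++ SEP ∷ rest)
    rewind-row as bs ls rest
      rewrite ++-ʳ++ (numbers f as) {SEP ∷ numbers g bs} {SEP ∷ ls}
            | ++-assoc (numbers f as) (SEP ∷ numbers g bs) (SEP ∷ rest) =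
      rewind-back (numbers g bs) (numbers-rewind g successors bs) refl
        ⊕ rewind-back (numbers f as) (numbers-rewind f labels as) refl
        ⊕ forward refl done

    -- A row is traversed forth, back and forth again. Its last SEP is read only twice, but the SEP
    -- before the row once, so the total is exactly three times the length.
    row-length : ∀ as bs →
      length (body as bs) + (suc (length (numbers g bs)) + (suc (length (numbers f as)) + 1) + (length (body as bs) + 1))
        ≡ 3 * length (row as bs)
    row-length as bs
      rewrite length-++ (body as bs) {[ SEP ]} | length-++ (numbers f as) {SEP ∷ numbers g bs} =
      solve 2 (λ l s → (l :+ (con 1 :+ s)) :+ ((con 1 :+ s) :+ ((con 1 :+ l) :+ con 1) :+ ((l :+ (con 1 :+ s)) :+ con 1))
                         := con 3 :* ((l :+ (con 1 :+ s)) :+ con 1))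
              refl (length (numbers f as)) (length (numbers g bs))
      where open +-*-Solver

    row-copies : ∀ as bs ls rest →
      (start 0F labels , SEP ∷ ls , row as bs ++ rest) ⇒[ 3 * length (row as bs) , copies as bs ]
      (start 0F labels , SEP ∷ body as bs ʳ++ (SEP ∷ ls) , rest)
    row-copies as bs ls rest
      rewrite sym (row-length as bs) | ++-assoc (body as bs) [ SEP ] rest =
      body-pass 0F as bs _ _ ⊕ rewind-row as bs ls rest ⊕ body-pass 1F as bs _ _ ⊕ forward refl done

  rows-copies : ∀ {A B : Set} (f : A → ℕ) (g : B → ℕ) n (as : Fin n → List A) (bs : Fin n → List B) ls →
    ∃ λ ls′ →
    (start 0F labels , SEP ∷ ls , concat (tabulate λ w → row f g (as w) (bs w)))
      ⇒[ 3 * length (concat (tabulate λ w → row f g (as w) (bs w)))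
       , concat (tabulate λ w → copies f g (as w) (bs w)) ]
    (start 0F labels , ls′ , [])
  rows-copies f g zero as bs ls = SEP ∷ ls , done
  rows-copies f g (suc n) as bs ls
    rewrite length-++ (row f g (as zero) (bs zero)) {concat (tabulate λ w → row f g (as (suc w)) (bs (suc w)))}
          | *-distribˡ-+ 3 (length (row f g (as zero) (bs zero)))
              (length (concat (tabulate λ w → row f g (as (suc w)) (bs (suc w))))) =
    proj₁ rest , row-copies f g (as zero) (bs zero) ls _ ⊕ proj₂ rest
    where rest = rows-copies f g n (as ∘ suc) (bs ∘ suc) (body f g (as zero) (bs zero) ʳ++ (SEP ∷ ls))

  formula-pass : ∀ xs → All (λ x → transition formula x ≡ (formula , image x , x , right)) xs →
                 Pass formula xs (concatMap (toList ∘ image) xs) formula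
  formula-pass []       []         = []ᵖ
  formula-pass (x ∷ xs) (eq ∷ eqs) = eq ∷ᵖ formula-pass xs eqs

  digits-pass : ∀ n → Pass rootNumeral (digits n) (digits n) rootNumeral
  digits-pass 0ᵇ       = []ᵖ
  digits-pass 2[1+ n ] = refl ∷ᵖ digits-pass n
  digits-pass 1+[2 n ] = refl ∷ᵖ digits-pass n

  emit : ∀ p {q t u n d} → ((q , []) , t ∷ written (toList p ʳ++ u) ∷ []) ⇓[ n ] d →
         ((q , p) , t ∷ written u ∷ []) ⇓[ length (toList p) + n ] d
  emit p = go (toList p) p refl
    where
    -- `weaken` hides the structural decrease of `p`, so the recursion follows the plain list.
    go : ∀ o (p : Upto Symbol bound) → toList p ≡ o → ∀ {q t u n d} →
         ((q , []) , t ∷ written (o ʳ++ u) ∷ []) ⇓[ n ] d →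
         ((q , p) , t ∷ written u ∷ []) ⇓[ length o + n ] d
    go []       []      refl h = h
    go (s ∷ o)  (s ∷ p) refl {q} {tape ls x rs} {u} h =
      step (cong₂ (λ t t′ → just ((q , weaken p) , t ∷ t′ ∷ [])) (act-stay ls rs) (act-write u))
           (go o (weaken p) (toList-weaken p) h)

  emit-≤ : ∀ p {q t u n d} → ((q , []) , t ∷ written (toList p ʳ++ u) ∷ []) ⇓[ n ] d →
           ∃ λ k → k ≤ bound + n × ((q , p) , t ∷ written u ∷ []) ⇓[ k ] d
  emit-≤ p h = _ , +-monoˡ-≤ _ (length-toList p) , emit p h

  successor-act : ∀ {q q′ o x y move} t → Tape.head t ≡ just x → transition q x ≡ (q′ , o , y , move) → ∀ u →
    successor ((q , []) , t ∷ written u ∷ []) ≡ just ((q′ , o) , act t (just y , move) ∷ written u ∷ [])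
  successor-act (tape ls _ rs) refl eq u rewrite eq | act-stay (map just u) {nothing} {nothing} [] = refl

  config : Configuration → List Symbol → TM.Config machine
  config (q , ls , xs) u = (q , []) , at ls xs ∷ written u ∷ []

  simulate-step : ∀ {q q′ o x ls xs t u v c n m d} →
    successor (config (q , ls , x ∷ xs) u) ≡ just ((q′ , o) , t ∷ written u ∷ []) →
    (∀ {u} → config c (v ʳ++ u) ⇓[ n ] d → ∃ λ k → k ≤ m + n × ((q′ , []) , t ∷ written u ∷ []) ⇓[ k ] d) →
    config c ((toList o ++ v) ʳ++ u) ⇓[ n ] d →
    ∃ λ k → k ≤ suc bound + m + n × config (q , ls , x ∷ xs) u ⇓[ k ] d
  simulate-step {o = o} {u = u} {v} {n = n} {m} eq continue h
    rewrite ++-ʳ++ (toList o) {v} {u} | +-assoc bound m n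
    with k , k≤ , h′ ← continue h
    with l , l≤ , h″ ← emit-≤ o h′ =
    suc l , s≤s (≤-trans l≤ (+-monoʳ-≤ bound k≤)) , step eq h″

  -- Each counted step is one machine step followed by at most `bound` writes. As `⇓` describes only
  -- computations that halt, a run is put in front of a halting one.
  simulate : ∀ {c c′ N o} → c ⇒[ N , o ] c′ → ∀ {u n d} → config c′ (o ʳ++ u) ⇓[ n ] d →
             ∃ λ k → k ≤ N * suc bound + n × config c u ⇓[ k ] d
  simulate done h = _ , ≤-refl , h
  simulate (forward {q} {ls = ls} {xs} {v = v} eq r) {u} h =
    simulate-step {v = v}
      (trans (successor-act {q} (at ls (_ ∷ xs)) refl eq u) (cong (λ t → just (_ , t ∷ _)) (act-right ls xs)))
      (simulate r) h
  simulate (back {q} {z = z} {ls} {xs} {v = v} eq r) {u} h =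
    simulate-step {v = v} (successor-act {q} (at (z ∷ ls) (_ ∷ xs)) refl eq u) (simulate r) h

  load-at : ∀ w → load w ≡ at [] w
  load-at []      = refl
  load-at (_ ∷ _) = refl

  contents-written : ∀ u → contents (written u) ≡ reverse u
  contents-written u = begin
    catMaybes (reverse (map just u) ++ [ nothing ])  ≡⟨ catMaybes-++ (reverse (map just u)) [ nothing ] ⟩
    catMaybes (reverse (map just u)) ++ []           ≡⟨ ++-identityʳ _ ⟩
    catMaybes (reverse (map just u))                 ≡⟨ cong catMaybes (reverse-map just u) ⟨
    mapMaybe just (reverse u)                        ≡⟨ mapMaybe-just (reverse u) ⟩
    reverse u                                        ∎
    where open ≡-Reasoning

  -- The additional `bound` pays for the preamble, pending in the initial state before any input is
  -- read.
  computes : ∀ {w N o ls} → (formula , [] , w) ⇒[ N , o ] (start 0F labels , ls , []) →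
             TM.Computes_to_within_ machine w (toList preamble ++ o) (bound + N * suc bound)
  computes {w} {N} {o} {ls} r
    with k , k≤ , h ← simulate r {u = toList preamble ʳ++ []} (halt refl)
    with l , l≤ , h′ ← emit-≤ preamble {u = []} h
    rewrite load-at w =
    l , _ , h′ , ≤-trans l≤ (+-monoʳ-≤ bound (≤-trans k≤ (≤-reflexive (+-identityʳ _)))) ,
    (begin
      contents (written (o ʳ++ toList preamble ʳ++ []))  ≡⟨ contents-written (o ʳ++ toList preamble ʳ++ []) ⟩
      reverse (o ʳ++ toList preamble ʳ++ [])             ≡⟨ cong reverse (++-ʳ++ (toList preamble)) ⟨
      reverse (reverse (toList preamble ++ o))           ≡⟨ reverse-involutive _ ⟩
      toList preamble ++ o                               ∎)
    where open ≡-Reasoning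

-- Codes of the translated formula and of the doubled model.

number-double : ∀ k (b : Fin 2) → number (suc (2 * k + toℕ b)) ≡ digit b ∷ number k
number-double k 0F = cong (λ n → digits n ++ [ END ]) (begin
  fromℕ (suc (2 * k + 0))                      ≡⟨ cong (fromℕ ∘ suc) (+-identityʳ (2 * k)) ⟩
  fromℕ (suc (2 * k))                          ≡⟨ cong (λ n → fromℕ (suc (2 * n))) (toℕ-fromℕ k) ⟨
  fromℕ (toℕᵇ 1+[2 fromℕ k ])            ≡⟨ fromℕ-toℕ _ ⟩
  1+[2 fromℕ k ]                               ∎)
  where open ≡-Reasoning
number-double k 1F = cong (λ n → digits n ++ [ END ]) (begin
  fromℕ (suc (2 * k + 1))                      ≡⟨ cong fromℕ (trans (cong suc (+-comm (2 * k) 1)) (sym (*-suc 2 k))) ⟩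
  fromℕ (2 * suc k)                            ≡⟨ cong (λ n → fromℕ (2 * suc n)) (toℕ-fromℕ k) ⟨
  fromℕ (toℕᵇ 2[1+ fromℕ k ])            ≡⟨ fromℕ-toℕ _ ⟩
  2[1+ fromℕ k ]                               ∎)
  where open ≡-Reasoning

number-fresh : ∀ p → number (fresh p) ≡ ONE ∷ number p
number-fresh p = trans (cong (number ∘ suc) (sym (+-identityʳ (2 * p)))) (number-double p 0F)

concat-tabulate-pairs : ∀ {A : Set} n (f : Fin (n * 2) → List A) →
  concat (tabulate f) ≡ concat (tabulate {n = n} λ w → f (combine w 0F) ++ f (combine w 1F))
concat-tabulate-pairs zero    f = refl
concat-tabulate-pairs (suc n) f =
  trans (cong (λ xs → f 0F ++ f 1F ++ xs) (concat-tabulate-pairs n (λ x → f (suc (suc x)))))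
        (sym (++-assoc (f 0F) (f 1F) _))

-- A guard put in front of every connective and a modality in front of
-- every temporal operator act on Polish notation symbol by symbol.
module Image (g m : Upto Symbol 10) where

  image : Symbol → Upto Symbol bound
  -- `pad 10` stands in for the modality, so that all these clauses have the same bound 10 + (10 +
  -- 4).
  image PROP  = g ++ᵘ pad 10 (PROP ∷ ONE ∷ [])
  image NPROP = g ++ᵘ pad 10 (NPROP ∷ ONE ∷ [])
  image OR    = g ++ᵘ pad 10 (OR ∷ [])
  image AND   = g ++ᵘ pad 10 (AND ∷ [])
  image NEXT  = g ++ᵘ m ++ᵘ (NEXT ∷ [])
  image UNTIL = g ++ᵘ m ++ᵘ (UNTIL ∷ [])
  image WEAK  = g ++ᵘ m ++ᵘ (WEAK ∷ [])
  image x     = x ∷ []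

  images : List Symbol → List Symbol
  images = concatMap (toList ∘ image)

  images-digits : ∀ n → images (digits n ++ [ END ]) ≡ digits n ++ [ END ]
  images-digits 0ᵇ       = refl
  images-digits 2[1+ n ] = cong (TWO ∷_) (images-digits n)
  images-digits 1+[2 n ] = cong (ONE ∷_) (images-digits n)

  module _ (guard modal : Formula → Formula)
           (encode-guard : ∀ θ → encodeᶠ (guard θ) ≡ toList g ++ encodeᶠ θ)
           (encode-modal : ∀ θ → encodeᶠ (modal θ) ≡ toList m ++ encodeᶠ θ) where

    private
      tr : ∀ {φ} → TeamLTL [] φ → Formula
      tr = Translation.translate guard modal fresh

    encode-literal : ∀ s p → toList (image s) ≡ toList g ++ s ∷ ONE ∷ [] →
                     toList g ++ s ∷ number (fresh p) ≡ images (s ∷ number p)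
    encode-literal s p eq = begin
      toList g ++ s ∷ number (fresh p)           ≡⟨ cong (λ w → toList g ++ s ∷ w) (number-fresh p) ⟩
      toList g ++ s ∷ ONE ∷ number p             ≡⟨ ++-assoc (toList g) (s ∷ ONE ∷ []) (number p) ⟨
      (toList g ++ s ∷ ONE ∷ []) ++ number p     ≡⟨ cong₂ _++_ eq (images-digits (fromℕ p)) ⟨
      toList (image s) ++ images (number p)      ∎
      where open ≡-Reasoning

    encode-operator : ∀ s u {v} → toList (image s) ≡ toList g ++ [ s ] → v ≡ images u →
                      toList g ++ s ∷ v ≡ images (s ∷ u)
    encode-operator s u {v} eq eq′ = begin
      toList g ++ s ∷ v                          ≡⟨ ++-assoc (toList g) [ s ] v ⟨
      (toList g ++ [ s ]) ++ v                   ≡⟨ cong₂ _++_ eq (sym eq′) ⟨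
      toList (image s) ++ images u               ∎
      where open ≡-Reasoning

    encode-modality : ∀ s u {v} → toList (image s) ≡ toList g ++ toList m ++ [ s ] → v ≡ images u →
                      toList g ++ toList m ++ s ∷ v ≡ images (s ∷ u)
    encode-modality s u {v} eq eq′ = begin
      toList g ++ toList m ++ s ∷ v              ≡⟨ cong (toList g ++_) (++-assoc (toList m) [ s ] v) ⟨
      toList g ++ (toList m ++ [ s ]) ++ v       ≡⟨ ++-assoc (toList g) (toList m ++ [ s ]) v ⟨
      (toList g ++ toList m ++ [ s ]) ++ v       ≡⟨ cong₂ _++_ eq (sym eq′) ⟨
      toList (image s) ++ images u               ∎
      where open ≡-Reasoning

    image-modality : ∀ s → toList (g ++ᵘ m ++ᵘ (s ∷ [] {n = 3})) ≡ toList g ++ toList m ++ [ s ]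
    image-modality s = trans (toList-++ᵘ g _) (cong (toList g ++_) (toList-++ᵘ m _))

    encode-guard-modal : ∀ θ → encodeᶠ (guard (modal θ)) ≡ toList g ++ toList m ++ encodeᶠ θ
    encode-guard-modal θ = trans (encode-guard _) (cong (toList g ++_) (encode-modal θ))

    encode-translate : ∀ {φ} (d : TeamLTL [] φ) → encodeᶠ (tr d) ≡ images (encodeᶠ φ)
    encode-pair : ∀ {φ ψ} (d : TeamLTL [] φ) (e : TeamLTL [] ψ) →
                  encodeᶠ (tr d) ++ encodeᶠ (tr e) ≡ images (encodeᶠ φ ++ encodeᶠ ψ)

    encode-translate (prop p) = trans (encode-guard _) (encode-literal PROP p (toList-++ᵘ g _))
    encode-translate (nprop p) = trans (encode-guard _) (encode-literal NPROP p (toList-++ᵘ g _))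
    encode-translate (disj {φ} {ψ} d e) =
      trans (encode-guard _) (encode-operator OR (encodeᶠ φ ++ encodeᶠ ψ) (toList-++ᵘ g _) (encode-pair d e))
    encode-translate (conj {φ} {ψ} d e) =
      trans (encode-guard _) (encode-operator AND (encodeᶠ φ ++ encodeᶠ ψ) (toList-++ᵘ g _) (encode-pair d e))
    encode-translate (next {φ} d) =
      trans (encode-guard-modal _) (encode-modality NEXT (encodeᶠ φ) (image-modality NEXT) (encode-translate d))
    encode-translate (until {φ} {ψ} d e) =
      trans (encode-guard-modal _) (encode-modality UNTIL (encodeᶠ φ ++ encodeᶠ ψ) (image-modality UNTIL) (encode-pair d e))
    encode-translate (weak {φ} {ψ} d e) =
      trans (encode-guard-modal _) (encode-modality WEAK (encodeᶠ φ ++ encodeᶠ ψ) (image-modality WEAK) (encode-pair d e))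
    encode-translate (bor () _ _)
    encode-translate (ne ())
    encode-translate (incl () _ _)

    encode-pair {φ} {ψ} d e = trans (cong₂ _++_ (encode-translate d) (encode-translate e))
                                    (sym (concatMap-++ (toList ∘ image) (encodeᶠ φ) (encodeᶠ ψ)))

  module _ (preamble : Upto Symbol bound) where
    open Machine preamble image

    Copied : Symbol → Set
    Copied x = transition formula x ≡ (formula , image x , x , right)

    copied-digits : ∀ n → All Copied (digits n ++ [ END ])
    copied-digits 0ᵇ       = refl ∷ []
    copied-digits 2[1+ n ] = refl ∷ copied-digits n
    copied-digits 1+[2 n ] = refl ∷ copied-digits n

    -- SEP is the only symbol at which `formula` is left, and it does not occur in the code of a
    -- formula.
    copied-formula : ∀ {φ} → TeamLTL [] φ → All Copied (encodeᶠ φ)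
    copied-formula (prop p)    = refl ∷ copied-digits (fromℕ p)
    copied-formula (nprop p)   = refl ∷ copied-digits (fromℕ p)
    copied-formula (disj d e)  = refl ∷ ++⁺ (copied-formula d) (copied-formula e)
    copied-formula (conj d e)  = refl ∷ ++⁺ (copied-formula d) (copied-formula e)
    copied-formula (next d)    = refl ∷ copied-formula d
    copied-formula (until d e) = refl ∷ ++⁺ (copied-formula d) (copied-formula e)
    copied-formula (weak d e)  = refl ∷ ++⁺ (copied-formula d) (copied-formula e)
    copied-formula (bor () _ _)
    copied-formula (ne ())
    copied-formula (incl () _ _)

    module _ (K : Kripke) where
      open Kripke K hiding (Traces)
      open Doubling K

      rows outputRows : List Symbol
      rows       = concat (tabulate λ w → row id toℕ (label w) (succs w))
      outputRows = concat (tabulate λ w → copies id toℕ (label w) (succs w))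

      encode-rows : encodeᴷ K ≡ number (toℕ root) ++ rows
      encode-rows = cong (λ xs → number (toℕ root) ++ concat xs)
        (tabulate-cong λ w → sym (++-assoc (concatMap number (label w)) _ [ SEP ]))

      rowWord : List AP → List (Fin (suc (states * 2))) → List Symbol
      rowWord ps vs = concatMap number ps ++ SEP ∷ concatMap (number ∘ toℕ) vs ++ [ SEP ]

      number-copy : ∀ w b → number (toℕ (copy w b)) ≡ digit b ∷ number (toℕ w)
      number-copy w b = trans (cong (number ∘ suc) (toℕ-combine w b)) (number-double (toℕ w) b)

      numbers-fresh : ∀ ps → concatMap number (map fresh ps) ≡ prefixed id ONE ps
      numbers-fresh ps = trans (concatMap-map number fresh ps) (concatMap-cong number-fresh ps)

      numbers-copy : ∀ b vs → concatMap (number ∘ toℕ) (map (λ v → copy v b) vs) ≡ prefixed toℕ (digit b) vs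
      numbers-copy b vs = trans (concatMap-map (number ∘ toℕ) (λ v → copy v b) vs)
                                (concatMap-cong (λ v → number-copy v b) vs)

      encode-copies : ∀ w →
        rowWord (D.label (copy w 0F)) (D.succs (copy w 0F)) ++ rowWord (D.label (copy w 1F)) (D.succs (copy w 1F))
          ≡ copies id toℕ (label w) (succs w)
      encode-copies w
        rewrite label-copy w 0F | label-copy w 1F | succs-copy w 0F | succs-copy w 1F
              | numbers-fresh (label w) | numbers-copy 0F (succs w) | numbers-copy 1F (succs w) = begin
        (P ++ SEP ∷ Q₁ ++ [ SEP ]) ++ END ∷ (P ++ SEP ∷ Q₀ ++ [ SEP ])
          ≡⟨ ++-assoc P (SEP ∷ Q₁ ++ [ SEP ]) _ ⟩
        P ++ SEP ∷ (Q₁ ++ [ SEP ]) ++ END ∷ (P ++ SEP ∷ Q₀ ++ [ SEP ])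
          ≡⟨ cong (λ u → P ++ SEP ∷ u) (++-assoc Q₁ [ SEP ] _) ⟩
        P ++ SEP ∷ Q₁ ++ SEP ∷ END ∷ (P ++ SEP ∷ Q₀ ++ [ SEP ])
          ≡⟨ ++-assoc P (SEP ∷ Q₁) _ ⟨
        (P ++ SEP ∷ Q₁) ++ SEP ∷ END ∷ (P ++ SEP ∷ Q₀ ++ [ SEP ])
          ≡⟨ cong (λ u → (P ++ SEP ∷ Q₁) ++ SEP ∷ END ∷ u) (++-assoc P (SEP ∷ Q₀) [ SEP ]) ⟨
        copies id toℕ (label w) (succs w) ∎
        where
        open ≡-Reasoning
        P = prefixed id ONE (label w)
        Q₀ = prefixed toℕ ONE (succs w)
        Q₁ = prefixed toℕ TWO (succs w)

      encode-doubled : encodeᴷ doubled ≡ ONE ∷ number (toℕ root) ++ SEP ∷ END ∷ SEP ∷ outputRows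
      encode-doubled = cong₂ _++_ (number-copy root 0F) (cong (λ u → SEP ∷ END ∷ SEP ∷ u) (trans
        (concat-tabulate-pairs states (λ x → rowWord (D.label (suc x)) (D.succs (suc x))))
        (cong concat (tabulate-cong encode-copies))))

      rootDigits : List Symbol
      rootDigits = digits (fromℕ (toℕ root))

      encode-input : ∀ φ → encode φ K ≡ (encodeᶠ φ ++ SEP ∷ rootDigits) ++ END ∷ rows
      encode-input φ = begin
        encodeᶠ φ ++ SEP ∷ encodeᴷ K
          ≡⟨ cong (λ u → encodeᶠ φ ++ SEP ∷ u) encode-rows ⟩
        encodeᶠ φ ++ SEP ∷ (rootDigits ++ [ END ]) ++ rows
          ≡⟨ cong (λ u → encodeᶠ φ ++ SEP ∷ u) (++-assoc rootDigits [ END ] rows) ⟩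
        encodeᶠ φ ++ SEP ∷ rootDigits ++ END ∷ rows
          ≡⟨ ++-assoc (encodeᶠ φ) (SEP ∷ rootDigits) _ ⟨
        (encodeᶠ φ ++ SEP ∷ rootDigits) ++ END ∷ rows ∎
        where open ≡-Reasoning

      encode-output : ∀ u →
        (u ++ SEP ∷ ONE ∷ rootDigits) ++ END ∷ SEP ∷ END ∷ SEP ∷ outputRows ≡ u ++ SEP ∷ encodeᴷ doubled
      encode-output u = begin
        (u ++ SEP ∷ ONE ∷ rootDigits) ++ END ∷ SEP ∷ END ∷ SEP ∷ outputRows
          ≡⟨ ++-assoc u _ _ ⟩
        u ++ SEP ∷ ONE ∷ rootDigits ++ END ∷ SEP ∷ END ∷ SEP ∷ outputRows
          ≡⟨ cong (λ v → u ++ SEP ∷ ONE ∷ v) (++-assoc rootDigits [ END ] _) ⟨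
        u ++ SEP ∷ ONE ∷ (rootDigits ++ [ END ]) ++ SEP ∷ END ∷ SEP ∷ outputRows
          ≡⟨ cong (λ v → u ++ SEP ∷ v) encode-doubled ⟨
        u ++ SEP ∷ encodeᴷ doubled ∎
        where open ≡-Reasoning

      transitions : Formula → ℕ
      transitions φ = length (encodeᶠ φ ++ SEP ∷ rootDigits) + suc (3 * length rows)

      run : ∀ {φ} (d : TeamLTL [] φ) → ∃ λ ls →
        (formula , [] , encode φ K) ⇒[ transitions φ , images (encodeᶠ φ) ++ SEP ∷ encodeᴷ doubled ]
        (start 0F labels , ls , [])
      run {φ} d rewrite encode-input φ | sym (encode-output (images (encodeᶠ φ))) =
        proj₁ rest , head [] (END ∷ rows) ⊕ forward refl (proj₂ rest)
        where
        head : Pass formula (encodeᶠ φ ++ SEP ∷ rootDigits) (images (encodeᶠ φ) ++ SEP ∷ ONE ∷ rootDigits) rootNumeral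
        head = formula-pass (encodeᶠ φ) (copied-formula d) ++ᵖ refl ∷ᵖ digits-pass (fromℕ (toℕ root))
        rest = rows-copies id toℕ states label succs ((encodeᶠ φ ++ SEP ∷ rootDigits) ʳ++ [])

      -- 75 is 3 times 25: at most three readings per symbol, each with at most 24 writes. The share
      -- of the root numeral's END covers its own reading, that of the SEP before the model, and the
      -- preamble.
      transitions-linear : ∀ φ → bound + transitions φ * suc bound ≤ 75 * (length (encodeᶠ φ) + length (encodeᴷ K))
      transitions-linear φ
        rewrite encode-rows | length-++ (encodeᶠ φ) {SEP ∷ rootDigits}
              | length-++ (rootDigits ++ [ END ]) {rows} | length-++ rootDigits {[ END ]} =
        ≤-trans (m≤m+n _ (50 * f + 50 * r + 1)) (≤-reflexive (solve 3 (λ f r k →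
          (con 24 :+ (f :+ (con 1 :+ r) :+ (con 1 :+ con 3 :* k)) :* con 25) :+ (con 50 :* f :+ con 50 :* r :+ con 1)
            := con 75 :* (f :+ (r :+ con 1 :+ k))) refl f r (length rows)))
        where
        open +-*-Solver
        f = length (encodeᶠ φ)
        r = length rootDigits

-- Assembling the reductions.

module _ (Q : Problem) (preamble : Upto Symbol bound) (g m : Upto Symbol 10) (guard modal : Formula → Formula) where
  open Problem Q
  open Image g m
  open Translation guard modal fresh using () renaming (translate to target)

  -- Leaves to each target the prefix words, admissibility, and correctness on non-empty clocked
  -- teams. `wrap` adds what is said once, `guard` and `modal` what is repeated inside.
  reduction :
    (∀ θ → encodeᶠ (guard θ) ≡ toList g ++ encodeᶠ θ) →
    (∀ θ → encodeᶠ (modal θ) ≡ toList m ++ encodeᶠ θ) →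
    (wrap : Formula → Formula) → (∀ θ → encodeᶠ (wrap θ) ≡ toList preamble ++ encodeᶠ θ) →
    (∀ {φ} (d : TeamLTL [] φ) → Admissible (wrap (target d))) →
    (∀ {φ} (d : TeamLTL [] φ) T → Index T → Clocked T →
      (T , lockstep , 0 ⊨ rename fresh d) ⇔ (T ⊨* wrap (target d))) →
    LinearTimeReducible sync-TeamLTL Q
  reduction encode-guard encode-modal wrap encode-wrap admissible correct =
    Machine.machine preamble image , 75 , λ φ K d →
      let open Doubling K in
      wrap (target d) , doubled , admissible d , computes-reduct K d ,
      correct d (Traces doubled) (lift path) doubled-clocked ⇔-∘ (doubled-⇔ d ⇔-∘ ⊨ₛ-lockstep d (Traces K) path)
    where
    computes-reduct : ∀ {φ} K (d : TeamLTL [] φ) →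
      TM.Computes_to_within_ (Machine.machine preamble image) (encode φ K)
        (encode (wrap (target d)) (Doubling.doubled K)) (75 * (length (encodeᶠ φ) + length (encodeᴷ K)))
    computes-reduct {φ} K d
      with n , c , halts , n≤ , out ← Machine.computes preamble image (proj₂ (run preamble K d)) =
      n , c , halts , ≤-trans n≤ (transitions-linear preamble K φ) , trans out (begin
        toList preamble ++ images (encodeᶠ φ) ++ v
          ≡⟨ ++-assoc (toList preamble) _ v ⟨
        (toList preamble ++ images (encodeᶠ φ)) ++ v
          ≡⟨ cong (λ u → (toList preamble ++ u) ++ v) (encode-translate guard modal encode-guard encode-modal d) ⟨
        (toList preamble ++ encodeᶠ (target d)) ++ v
          ≡⟨ cong (_++ v) (encode-wrap (target d)) ⟨
        encodeᶠ (wrap (target d)) ++ v ∎)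
      where
      open ≡-Reasoning
      v = SEP ∷ encodeᴷ (Doubling.doubled K)

theorem4p3 : ExcludedMiddle 0ℓ → Extensionality 0ℓ 0ℓ →
    LinearTimeReducible sync-TeamLTL (∃TeamLTL [])
    × LinearTimeReducible sync-TeamLTL (∀TeamLTL (bor ∷ ne ∷ []))
    × LinearTimeReducible sync-TeamLTL (∃TeamCTL (bor ∷ []))
    × LinearTimeReducible sync-TeamLTL (∀TeamCTL (incl ∷ []))
theorem4p3 em _ =
  reduction (∃TeamLTL [])
    -- The code of `always-uniform` behind its conjunction sign; an END without digits is the
    -- numeral 0 of the clock.
    (AND ∷ WEAK ∷ UNTIL ∷ PROP ∷ END ∷ NPROP ∷ END ∷ AND ∷ PROP ∷ END ∷ NPROP ∷ END ∷ [])
    [] [] id id (λ _ → refl) (λ _ → refl) (always-uniform ∧_) (λ _ → refl)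
    (λ d → conj (weak (until (prop clock) (nprop clock)) (conj (prop clock) (nprop clock))) (rename-TeamLTL fresh d))
    (λ d T t₀ clk → mk⇔ (LTL∃.complete d T t₀ clk) (LTL∃.sound d T t₀ clk)) ,
  reduction (∀TeamLTL (bor ∷ ne ∷ []))
    (BOR ∷ UNTIL ∷ OR ∷ PROP ∷ END ∷ NPROP ∷ END
         ∷ OR ∷ AND ∷ NONEMPTY ∷ PROP ∷ END ∷ AND ∷ NONEMPTY ∷ NPROP ∷ END ∷ [])
    [] [] id id (λ _ → refl) (λ _ → refl) (sometimes-mixed ∨ᴮ_) (λ _ → refl)
    (λ d → bor (here refl)
      (until (disj (prop clock) (nprop clock))
             (disj (conj (ne (there (here refl))) (prop clock)) (conj (ne (there (here refl))) (nprop clock))))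
      (rename-TeamLTL fresh d))
    (λ d T t₀ clk → mk⇔ (LTL∀.complete em d T t₀ clk) (LTL∀.sound em d T t₀ clk)) ,
  reduction (∃TeamCTL (bor ∷ []))
    []
    (AND ∷ BOR ∷ PROP ∷ END ∷ NPROP ∷ END ∷ [])
    (BOR ∷ AND ∷ PROP ∷ END ∷ NPROP ∷ END ∷ SOME ∷ [])
    (CTL∃.guard em) (CTL∃.modal em) (λ _ → refl) (λ _ → refl) id (λ _ → refl) (CTL∃.admissible em)
    (λ d T t₀ clk → mk⇔
      (λ h → lockstep , lockstep-tef T t₀ , (λ _ → refl) , CTL∃.complete em d T clk lockstep-Synced h)
      (λ (τ , tef , init , h) → CTL∃.sound em d T clk (Synced-initial init) h)) ,
  reduction (∀TeamCTL (incl ∷ []))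
    []
    -- In each pair of ENDs the first is the numeral of the clock and the second closes one side of
    -- the inclusion.
    (OR ∷ INCL ∷ PROP ∷ END ∷ END ∷ NPROP ∷ END ∷ END ∷ [])
    (ALL ∷ [])
    (CTL∀.guard em) (CTL∀.modal em) (λ _ → refl) (λ _ → refl) id (λ _ → refl) (CTL∀.admissible em)
    (λ d T t₀ clk → mk⇔
      (λ h τ tef init → CTL∀.complete em d T clk (Synced-initial init) h)
      (λ h → CTL∀.sound em d T clk lockstep-Synced (h lockstep (lockstep-tef T t₀) (λ _ → refl))))
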